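{- Let $p$ be an even positive integer. Then there exists a unique (up to isomorphism) graph of order $p+2$ and size $\mathrm{ex}(p+2,B_p)+1$ which contains exactly one copy of $B_p$, and there exists a unique (up to isomorphism) graph of order $p+3$ and size $\mathrm{ex}(p+3,B_p)+1$ which contains exactly one copy of $B_p$.
   Context: All graphs are finite and simple. The order of a graph is its number of vertices and its size is its number of edges. A copy of $H$ in $G$ is a subgraph of $G$ isomorphic to $H$; the number of copies of $H$ in $G$ is the number of distinct subgraphs of $G$ isomorphic to $H$. For a graph $H$ and a positive integer $n$, the Turán number $\mathrm{ex}(n,H)$ is the maximum size of a simple graph of order $n$ containing no copy of $H$. The book $B_p$ with $p$ pages is the graph consisting of $p$ triangles sharing a common edge (so $B_p$ has $p+2$ vertices and $2p+1$ edges). -}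

module Defs where

open import Data.Bool.Base using (Bool; true; false; _∧_; if_then_else_)
open import Data.Fin.Base using (Fin)
open import Data.Fin.Patterns using (0F; 1F)
open import Data.Fin.Properties using (_<?_)
open import Data.Fin.Subset using (Subset; _∈_)
open import Data.Nat.Base using (ℕ; _≤_)
open import Data.Nat.Properties using (+-0-commutativeMonoid)
open import Data.Product using (Σ; _×_; ∃; ∃!; proj₁)
open import Data.Sum.Base using (_⊎_; inj₁; inj₂)
open import Function.Bundles using (_↔_; module Inverse)
open import Relation.Binary.PropositionalEquality.Core using (_≡_; refl)
open import Relation.Nullary.Decidable.Core using (does)
open import Relation.Nullary.Negation.Core using (¬_)

open import Algebra.Properties.CommutativeMonoid.Sum +-0-commutativeMonoid
  using (sum-syntax)

-- Simple graphs with vertex type V.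
record Graph (V : Set) : Set where
  field
    adj    : V → V → Bool
    sym    : ∀ u v → adj u v ≡ adj v u
    irrefl : ∀ v → adj v v ≡ false

open Graph public using (adj)

-- The vertices of a graph of order n are taken to be Fin n; graphs are
-- only ever compared up to isomorphism.
FinGraph : ℕ → Set
FinGraph n = Graph (Fin n)

infix 4 _≅_

record _≅_ {V W : Set} (G : Graph V) (H : Graph W) : Set where
  field
    bijection : V ↔ W
    adj-cong  : ∀ u v →
      adj G u v ≡ adj H (Inverse.to bijection u) (Inverse.to bijection v)

-- Every edge {i , j} is counted once, as the pair with i < j.
size : ∀ {n} → FinGraph n → ℕ
size {n} G =
  ∑[ i < n ] ∑[ j < n ] (if does (i <? j) ∧ adj G i j then 1 else 0)

-- Subgraphs need be neither induced nor spanning.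
record Subgraph {n : ℕ} (G : FinGraph n) : Set where
  field
    vertices : Subset n
    edge     : Fin n → Fin n → Bool
    edge-sym : ∀ u v → edge u v ≡ edge v u
    edge⇒∈   : ∀ u v → edge u v ≡ true → u ∈ vertices × v ∈ vertices
    edge⇒adj : ∀ u v → edge u v ≡ true → adj G u v ≡ true

open Subgraph public using (vertices; edge)

infix 4 _≈_

-- Same vertex set and same edge set.
_≈_ : ∀ {n} {G : FinGraph n} → Subgraph G → Subgraph G → Set
S ≈ T = vertices S ≡ vertices T × (∀ u v → edge S u v ≡ edge T u v)

toGraph : ∀ {n} {G : FinGraph n} (S : Subgraph G) →
          Graph (Σ (Fin n) (_∈ vertices S))
toGraph {G = G} S = record
  { adj    = λ u v → edge S (proj₁ u) (proj₁ v)
  ; sym    = λ u v → Subgraph.edge-sym S (proj₁ u) (proj₁ v)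
  ; irrefl = λ v → loopless (proj₁ v)
  }
  where
  loopless : ∀ v → edge S v v ≡ false
  loopless v with edge S v v | Subgraph.edge⇒adj S v v
  ... | false | _ = refl
  ... | true  | e rewrite Graph.irrefl G v with () ← e refl

IsCopy : ∀ {W n} {G : FinGraph n} → Graph W → Subgraph G → Set
IsCopy H S = H ≅ toGraph S

ContainsCopy : ∀ {W n} → Graph W → FinGraph n → Set
ContainsCopy H G = ∃ λ (S : Subgraph G) → IsCopy H S

ContainsExactlyOneCopy : ∀ {W n} → Graph W → FinGraph n → Set
ContainsExactlyOneCopy H G = ∃! _≈_ λ (S : Subgraph G) → IsCopy H S

-- IsTuránNumber n H m says that m = ex(n, H).  As a maximum, m is
-- determined by n and H.
record IsTuránNumber {W : Set} (n : ℕ) (H : Graph W) (m : ℕ) : Set where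
  field
    attained : ∃ λ (G : FinGraph n) → ¬ ContainsCopy H G × size G ≡ m
    maximal  : ∀ (G : FinGraph n) → ¬ ContainsCopy H G → size G ≤ m

-- The two vertices in Fin 2 are the ends of the common edge; each vertex
-- in Fin p is the apex of one of the triangles.
Book : (p : ℕ) → Graph (Fin 2 ⊎ Fin p)
Book p = record { adj = adjacent ; sym = symmetric ; irrefl = irreflexive }
  where
  adjacent : Fin 2 ⊎ Fin p → Fin 2 ⊎ Fin p → Bool
  adjacent (inj₁ 0F) (inj₁ 1F) = true
  adjacent (inj₁ 1F) (inj₁ 0F) = true
  adjacent (inj₁ 0F) (inj₁ 0F) = false
  adjacent (inj₁ 1F) (inj₁ 1F) = false
  adjacent (inj₁ _)  (inj₂ _)  = true
  adjacent (inj₂ _)  (inj₁ _)  = true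
  adjacent (inj₂ _)  (inj₂ _)  = false

  symmetric : ∀ u v → adjacent u v ≡ adjacent v u
  symmetric (inj₁ 0F) (inj₁ 0F) = refl
  symmetric (inj₁ 0F) (inj₁ 1F) = refl
  symmetric (inj₁ 1F) (inj₁ 0F) = refl
  symmetric (inj₁ 1F) (inj₁ 1F) = refl
  symmetric (inj₁ 0F) (inj₂ _)  = refl
  symmetric (inj₁ 1F) (inj₂ _)  = refl
  symmetric (inj₂ _)  (inj₁ 0F) = refl
  symmetric (inj₂ _)  (inj₁ 1F) = refl
  symmetric (inj₂ _)  (inj₂ _)  = refl

  irreflexive : ∀ v → adjacent v v ≡ false
  irreflexive (inj₁ 0F) = refl
  irreflexive (inj₁ 1F) = refl
  irreflexive (inj₂ _)  = refl

{-# OPTIONS --safe #-}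
-- Pass to the complement C of G: few edges missing means small degrees in C,
-- and 2 · size G + Σ deg C = n (n − 1).
--
-- On p + 2 vertices a book spans G, and its spine is a pair of isolated
-- vertices of C.  So C of an extremal graph is a perfect matching, and with one
-- edge less C must be two isolated vertices plus a perfect matching of the rest.
--
-- On p + 3 vertices a book misses one vertex z, and its spine is a pair of
-- vertices having no neighbour in C but z.  Here C of an extremal graph is a
-- triangle plus a matching, and with one edge less all degrees in C turn out
-- positive and sum to n + 1, so C is a path on three vertices plus a matching.
--
-- In all cases C is a small core L plus a matching, which determines C up to
-- isomorphism.
module Submission where

open import Defs
open import Data.Nat.Properties as ℕ using (+-0-commutativeMonoid)
open import Algebra.Properties.CommutativeMonoid.Sum +-0-commutativeMonoid
  using (sum; sum-syntax; sum-cong-≗; ∑-distrib-+; ∑-comm)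
open import Axiom.UniquenessOfIdentityProofs.WithK using (uip)
open import Data.Bool.Base using (Bool; true; false; _∧_; not; if_then_else_; _xor_)
import Data.Bool.Properties as Bool
open import Data.Fin.Base as Fin using (Fin; zero; suc)
open import Data.Fin.Patterns using (0F; 1F; 2F)
open import Data.Fin.Permutation using (↔⇒≡)
open import Data.Fin.Properties as Fin using (_≟_; _<?_; any?; <-cmp)
open import Data.Fin.Subset using (Subset; ⊤) renaming (_∈_ to _∈ₛ_)
open import Data.Fin.Subset.Properties using (∈⊤) renaming (_∈?_ to _∈ₛ?_)
open import Data.List.Base using (List; []; _∷_; length)
import Data.List.Membership.DecPropositional as DecMembership
open import Data.List.Membership.Propositional using (_∈_; _∉_)
open import Data.List.Relation.Unary.All as All using (All; []; _∷_)
open import Data.List.Relation.Unary.AllPairs using ([]; _∷_)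
open import Data.List.Relation.Unary.Any using (here; there)
open import Data.List.Relation.Unary.Unique.Propositional using (Unique)
open import Data.Nat.Base using (ℕ; zero; suc; _+_; _*_; _≤_; _<_; z≤n; s≤s; ⌊_/2⌋)
open import Data.Nat.Divisibility using (_∣_; divides)
open import Data.Nat.Tactic.RingSolver using (solve-∀)
open import Data.Product using (∃; ∃₂; ∃!; _×_; _,_; proj₁; proj₂)
open import Data.Sum.Base as Sum using (_⊎_; inj₁; inj₂)
open import Data.Sum.Function.Propositional using (_⊎-↔_)
import Data.Sum.Properties as Sum
open import Data.Vec.Base using (lookup; tabulate)
open import Data.Vec.Properties
  using (lookup∘tabulate; []=⇒lookup; lookup⇒[]=; tabulate-cong; tabulate∘lookup)
open import Data.Vec.Properties.WithK using ([]=-irrelevant)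
open import Function.Base using (_∘_; flip)
open import Function.Bundles using (_↔_; mk↔ₛ′; module Inverse; _⇔_; mk⇔; module Equivalence)
open import Function.Properties.Inverse using (↔-refl; ↔-sym; ↔-trans)
open import Relation.Binary.Definitions using (tri<; tri≈; tri>)
open import Relation.Binary.PropositionalEquality
  using (_≡_; _≢_; refl; sym; trans; cong; cong₂; subst; module ≡-Reasoning)
open import Relation.Nullary using (Dec; yes; no; ¬_; contradiction; does)
open import Relation.Nullary.Decidable using (dec-true; dec-false; _×-dec_; _⊎-dec_; ¬?)

-- The value of ex(n, B_p) is never computed. Graphs of the same order are compared through
-- `size-compl`: each further edge lowers the degree sum of the complement by 2. So it suffices to
-- exhibit a book-free E and a graph U with exactly one book whose complements have degree sums
-- differing by 2, and to show that every G whose complement has degree sum that of U, or less by an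
-- even number, contains a book.
--
-- For order p + 3 one argument serves both extremality and uniqueness. The condition
-- `PendantsUnique` follows from having exactly one copy and holds vacuously if there is no copy.
-- Under it a small degree sum forces C to be a path on three vertices plus a matching. Such a C
-- yields a book, which refutes the case of no copy, and it is determined up to isomorphism, which
-- settles the case of one copy.
--
-- Evenness of p enters because the p vertices outside the core must be perfectly matched. Since p
-- is then at least 2, a book has at least four vertices and its spine can be read off the subgraph;
-- in a triangle each of the three edges could be the spine.

private variable
  n s r p : ℕ

open module Membership {n : ℕ} = DecMembership (_≟_ {n}) using (_∈?_)

-- Sums and counting over finite index sets.

indicator : Bool → ℕ
indicator b = if b then 1 else 0

count : (Fin n → Bool) → ℕ
count {n} f = ∑[ i < n ] indicator (f i)

δ : Fin n → Fin n → ℕ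
δ i j = indicator (does (i ≟ j))

δ-same : (i : Fin n) → δ i i ≡ 1
δ-same i = cong indicator (dec-true (i ≟ i) refl)

δ-diff : {i j : Fin n} → i ≢ j → δ i j ≡ 0
δ-diff {i = i} {j} i≢j = cong indicator (dec-false (i ≟ j) i≢j)

sum-mono : {f g : Fin n → ℕ} → (∀ i → f i ≤ g i) → sum f ≤ sum g
sum-mono {zero}  f≤g = z≤n
sum-mono {suc n} f≤g = ℕ.+-mono-≤ (f≤g zero) (sum-mono (f≤g ∘ suc))

sum-const : ∀ n c → ∑[ i < n ] c ≡ n * c
sum-const zero    c = refl
sum-const (suc n) c = cong (c +_) (sum-const n c)

sum-pos : {f : Fin n → ℕ} → (∀ i → 1 ≤ f i) → n ≤ sum f
sum-pos {n} {f} 1≤f = subst (_≤ sum f) (trans (sum-const n 1) (ℕ.*-identityʳ n)) (sum-mono 1≤f)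

sum-ones : {f : Fin n → ℕ} → (∀ i → f i ≡ 1) → sum f ≡ n
sum-ones {n} f≡1 = trans (sum-cong-≗ f≡1) (trans (sum-const n 1) (ℕ.*-identityʳ n))

sum-select : (k : Fin n → ℕ) (j : Fin n) → ∑[ i < n ] (k i * δ i j) ≡ k j
sum-select {suc n} k zero = trans (cong₂ _+_ (ℕ.*-identityʳ (k zero))
    (trans (sum-cong-≗ λ i → ℕ.*-zeroʳ (k (suc i))) (trans (sum-const n 0) (ℕ.*-zeroʳ n))))
  (ℕ.+-identityʳ (k zero))
sum-select {suc n} k (suc j) =
  trans (cong (_+ ∑[ i < n ] (k (suc i) * δ i j)) (ℕ.*-zeroʳ (k zero))) (sum-select (k ∘ suc) j)

sum-zeros : {f : Fin n → ℕ} → (∀ i → f i ≡ 0) → sum f ≡ 0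
sum-zeros {n} f≡0 = trans (sum-cong-≗ f≡0) (trans (sum-const n 0) (ℕ.*-zeroʳ n))

δ-sym : (i j : Fin n) → δ i j ≡ δ j i
δ-sym i j with i ≟ j
... | yes refl = sym (δ-same i)
... | no  i≢j  = sym (δ-diff (i≢j ∘ sym))

sum-δ : (i : Fin n) → ∑[ j < n ] δ i j ≡ 1
sum-δ {n} i = trans (sum-cong-≗ λ j → trans (δ-sym i j) (sym (ℕ.*-identityˡ (δ j i))))
                    (sum-select (λ _ → 1) i)

sum-scale : ∀ c (f : Fin n → ℕ) → ∑[ i < n ] (c * f i) ≡ c * sum f
sum-scale {zero}  c f = sym (ℕ.*-zeroʳ c)
sum-scale {suc n} c f = trans (cong (c * f zero +_) (sum-scale c (f ∘ suc)))
                              (sym (ℕ.*-distribˡ-+ c (f zero) _))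

-- A strict inequality at `i` would leave room to add `δ i` to `f`, making the sum of `f` smaller
-- than that of `g`. This is what turns an exact degree sum into exact degrees.
sum-tight : {f g : Fin n → ℕ} → (∀ i → f i ≤ g i) → sum g ≤ sum f → ∀ i → f i ≡ g i
sum-tight {n} {f} {g} f≤g Σg≤Σf i with ℕ.m≤n⇒m<n∨m≡n (f≤g i)
... | inj₂ fi≡gi = fi≡gi
... | inj₁ fi<gi = contradiction Σf<Σf (ℕ.<-irrefl refl)
  where
  bump : ∀ j → δ i j + f j ≤ g j
  bump j with i ≟ j
  ... | yes refl = fi<gi
  ... | no  _    = f≤g j
  Σf<Σf : sum f < sum f
  Σf<Σf = ℕ.≤-trans
    (subst (_≤ sum g) (trans (∑-distrib-+ (δ i) f) (cong (_+ sum f) (sum-δ i))) (sum-mono bump))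
    Σg≤Σf

-- Turns a list of vertices into a weight function, so that comparing cardinalities becomes
-- comparing summands.
multiplicity : List (Fin n) → Fin n → ℕ
multiplicity []       i = 0
multiplicity (x ∷ xs) i = δ x i + multiplicity xs i

sum-multiplicity : (xs : List (Fin n)) → sum (multiplicity xs) ≡ length xs
sum-multiplicity {n} []   = sum-zeros {n} λ _ → refl
sum-multiplicity (x ∷ xs) = trans (∑-distrib-+ (δ x) (multiplicity xs))
                                  (cong₂ _+_ (sum-δ x) (sum-multiplicity xs))

multiplicity-∈ : {xs : List (Fin n)} {i : Fin n} → i ∈ xs → 1 ≤ multiplicity xs i
multiplicity-∈ {xs = x ∷ xs} (here refl) rewrite δ-same x = s≤s z≤n
multiplicity-∈ {xs = x ∷ xs} {i} (there i∈xs) = ℕ.≤-trans (multiplicity-∈ i∈xs) (ℕ.m≤n+m _ (δ x i))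

multiplicity-∉ : {xs : List (Fin n)} {i : Fin n} → i ∉ xs → multiplicity xs i ≡ 0
multiplicity-∉ {xs = []}     _     = refl
multiplicity-∉ {xs = x ∷ xs} i∉xxs =
  cong₂ _+_ (δ-diff (i∉xxs ∘ here ∘ sym)) (multiplicity-∉ (i∉xxs ∘ there))

multiplicity-unique : {xs : List (Fin n)} → Unique xs → ∀ i → multiplicity xs i ≤ 1
multiplicity-unique []            i = z≤n
multiplicity-unique {xs = x ∷ xs} (x∉xs ∷ xs!) i with x ≟ i
... | no  _    = multiplicity-unique xs! i
... | yes refl = s≤s (ℕ.≤-reflexive (multiplicity-∉ {xs = xs} λ x∈xs → All.lookup x∉xs x∈xs refl))

count-≤-length : {f : Fin n → Bool} (xs : List (Fin n)) →
                 (∀ i → f i ≡ true → i ∈ xs) → count f ≤ length xs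
count-≤-length {f = f} xs f⊆xs = subst (count f ≤_) (sum-multiplicity xs) (sum-mono bound)
  where
  bound : ∀ i → indicator (f i) ≤ multiplicity xs i
  bound i with f i in fi
  ... | false = z≤n
  ... | true  = multiplicity-∈ (f⊆xs i fi)

length-≤-count : {f : Fin n → Bool} {xs : List (Fin n)} →
                 Unique xs → All (λ i → f i ≡ true) xs → length xs ≤ count f
length-≤-count {f = f} {xs} xs! xs⊆f = subst (_≤ count f) (sum-multiplicity xs) (sum-mono bound)
  where
  bound : ∀ i → multiplicity xs i ≤ indicator (f i)
  bound i with i ∈? xs
  ... | yes i∈xs rewrite All.lookup xs⊆f i∈xs = multiplicity-unique xs! i
  ... | no  i∉xs rewrite multiplicity-∉ i∉xs  = z≤n

-- Pigeonhole. It supplies most vertices chosen later: a neighbour, a second neighbour, the vertex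
-- missed by a book.
count-witness : {f : Fin n → Bool} (xs : List (Fin n)) → length xs < count f →
                ∃ λ i → f i ≡ true × i ∉ xs
count-witness {f = f} xs lt with any? (λ i → (f i Bool.≟ true) ×-dec ¬? (i ∈? xs))
... | yes found = found
... | no  none  = contradiction (count-≤-length xs covered) (ℕ.<⇒≱ lt)
  where
  covered : ∀ i → f i ≡ true → i ∈ xs
  covered i fi with i ∈? xs
  ... | yes i∈xs = i∈xs
  ... | no  i∉xs = contradiction (i , fi , i∉xs) none

-- Booleans and enumeration of finite supports.

bool-ext : {a b : Bool} → (a ≡ true → b ≡ true) → (b ≡ true → a ≡ true) → a ≡ b
bool-ext {false} {false} _ _ = refl
bool-ext {true}  {true}  _ _ = refl
bool-ext {false} {true}  _ g = g refl
bool-ext {true}  {false} f _ = sym (f refl)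

true≢false : {b : Bool} → b ≡ true → b ≢ false
true≢false refl ()

≢true⇒false : {b : Bool} → b ≢ true → b ≡ false
≢true⇒false {false} _ = refl
≢true⇒false {true}  h = contradiction refl h

does-true : {A : Set} (a? : Dec A) → does a? ≡ true → A
does-true (yes a) _ = a

support-≡ : {f : Fin n → Bool} {x y : ∃ λ i → f i ≡ true} → proj₁ x ≡ proj₁ y → x ≡ y
support-≡ {x = i , p} {.i , q} refl = cong (i ,_) (uip p q)

enumerate : (f : Fin n → Bool) → Fin (count f) ↔ ∃ λ i → f i ≡ true
enumerate {zero}  f = mk↔ₛ′ (λ ()) (λ ()) (λ ()) (λ ())
enumerate {suc n} f with f zero in f0 | enumerate (f ∘ suc)
... | false | e = mk↔ₛ′ to′ from′ to∘from from∘to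
  where
  open Inverse e
  to′ : Fin (count (f ∘ suc)) → ∃ λ i → f i ≡ true
  to′ q = suc (proj₁ (to q)) , proj₂ (to q)
  from′ : (∃ λ i → f i ≡ true) → Fin (count (f ∘ suc))
  from′ (zero  , p) = contradiction f0 (true≢false p)
  from′ (suc i , p) = from (i , p)
  to∘from : ∀ x → to′ (from′ x) ≡ x
  to∘from (zero  , p) = contradiction f0 (true≢false p)
  to∘from (suc i , p) = cong (λ x → suc (proj₁ x) , proj₂ x) (strictlyInverseˡ (i , p))
  from∘to : ∀ q → from′ (to′ q) ≡ q
  from∘to q = strictlyInverseʳ q
... | true | e = mk↔ₛ′ to′ from′ to∘from from∘to
  where
  open Inverse e
  to′ : Fin (suc (count (f ∘ suc))) → ∃ λ i → f i ≡ true
  to′ zero    = zero , f0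
  to′ (suc q) = suc (proj₁ (to q)) , proj₂ (to q)
  from′ : (∃ λ i → f i ≡ true) → Fin (suc (count (f ∘ suc)))
  from′ (zero  , p) = zero
  from′ (suc i , p) = suc (from (i , p))
  to∘from : ∀ x → to′ (from′ x) ≡ x
  to∘from (zero  , p) = support-≡ {f = f} refl
  to∘from (suc i , p) = cong (λ x → suc (proj₁ x) , proj₂ x) (strictlyInverseˡ (i , p))
  from∘to : ∀ q → from′ (to′ q) ≡ q
  from∘to zero    = refl
  from∘to (suc q) = cong suc (strictlyInverseʳ q)

-- Bijections, isomorphisms and complements.

injective∧surjective⇒↔ : {A B : Set} (f : A → B) → (∀ {x y} → f x ≡ f y → x ≡ y) →
                         (∀ y → ∃ λ x → f x ≡ y) → A ↔ B
injective∧surjective⇒↔ f inj surj =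
  mk↔ₛ′ f (proj₁ ∘ surj) (proj₂ ∘ surj) (λ x → inj (proj₂ (surj (f x))))

≅-sym : {V W : Set} {G : Graph V} {H : Graph W} → G ≅ H → H ≅ G
≅-sym {H = H} φ = record
  { bijection = mk↔ₛ′ from to strictlyInverseʳ strictlyInverseˡ
  ; adj-cong  = λ u v → trans (sym (cong₂ (adj H) (strictlyInverseˡ u) (strictlyInverseˡ v)))
                              (sym (_≅_.adj-cong φ (from u) (from v))) }
  where open Inverse (_≅_.bijection φ)

≅-trans : {U V W : Set} {F : Graph U} {G : Graph V} {H : Graph W} → F ≅ G → G ≅ H → F ≅ H
≅-trans φ ψ = record
  { bijection = ↔-trans (_≅_.bijection φ) (_≅_.bijection ψ)
  ; adj-cong  = λ u v → trans (_≅_.adj-cong φ u v) (_≅_.adj-cong ψ _ _) }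

pullback : {V W : Set} → (V → W) → Graph W → Graph V
pullback f H = record
  { adj    = λ u v → adj H (f u) (f v)
  ; sym    = λ u v → Graph.sym H (f u) (f v)
  ; irrefl = λ v → Graph.irrefl H (f v) }

pullback-≅ : {V W : Set} (φ : V ↔ W) (H : Graph W) → pullback (Inverse.to φ) H ≅ H
pullback-≅ φ H = record { bijection = φ ; adj-cong = λ _ _ → refl }

compl : FinGraph n → FinGraph n
compl G = record
  { adj    = λ u v → not (does (u ≟ v)) ∧ not (adj G u v)
  ; sym    = λ u v → cong₂ (λ a b → not a ∧ not b)
               (bool-ext (λ p → dec-true (v ≟ u) (sym (does-true (u ≟ v) p)))
                         (λ p → dec-true (u ≟ v) (sym (does-true (v ≟ u) p))))
               (Graph.sym G u v)
  ; irrefl = λ v → cong (λ a → not a ∧ not (adj G v v)) (dec-true (v ≟ v) refl) }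

compl-≢ : (G : FinGraph n) {u v : Fin n} → u ≢ v → adj (compl G) u v ≡ not (adj G u v)
compl-≢ G {u} {v} u≢v = cong (λ a → not a ∧ not (adj G u v)) (dec-false (u ≟ v) u≢v)

compl-involutive : (G : FinGraph n) → ∀ u v → adj (compl (compl G)) u v ≡ adj G u v
compl-involutive G u v with u ≟ v
... | yes refl = sym (Graph.irrefl G u)
... | no  _    = Bool.not-involutive _

compl-≅ : {G H : FinGraph n} → G ≅ H → compl G ≅ compl H
compl-≅ {G = G} {H} φ = record { bijection = _≅_.bijection φ ; adj-cong = same }
  where
  open Inverse (_≅_.bijection φ)
  same : ∀ u v → adj (compl G) u v ≡ adj (compl H) (to u) (to v)
  same u v with u ≟ v
  ... | yes refl = sym (Graph.irrefl (compl H) (to u))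
  ... | no  u≢v  = trans (cong not (_≅_.adj-cong φ u v)) (sym (compl-≢ H (u≢v ∘ injective)))
    where
    injective : to u ≡ to v → u ≡ v
    injective eq = trans (sym (strictlyInverseʳ u)) (trans (cong from eq) (strictlyInverseʳ v))

compl-compl : (G : FinGraph n) → compl (compl G) ≅ G
compl-compl G = record { bijection = ↔-refl ; adj-cong = compl-involutive G }

≅-via-compl : {G H : FinGraph n} → compl G ≅ compl H → G ≅ H
≅-via-compl {G = G} {H} φ =
  ≅-trans (≅-sym (compl-compl G)) (≅-trans (compl-≅ φ) (compl-compl H))

-- Degrees and the size of the complement.

degree : FinGraph n → Fin n → ℕ
degree G i = count (adj G i)

degreeSum : FinGraph n → ℕ
degreeSum {n} G = ∑[ i < n ] degree G i

irreflexive : {G : FinGraph n} {i j : Fin n} → adj G i j ≡ true → i ≢ j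
irreflexive {G = G} {i} e refl = contradiction (Graph.irrefl G i) (true≢false e)

symmetric : {G : FinGraph n} {i j : Fin n} → adj G i j ≡ true → adj G j i ≡ true
symmetric {G = G} {i} {j} e = trans (Graph.sym G j i) e

-- The order on the vertices sends an edge of G to just one of the first two terms; a non-edge falls
-- to the complement, and the diagonal, which the complement omits, to `δ`.
trichotomy-count : (G : FinGraph n) → ∀ i j →
  indicator (does (i <? j) ∧ adj G i j) + indicator (does (j <? i) ∧ adj G j i)
    + (indicator (adj (compl G) i j) + δ i j) ≡ 1
trichotomy-count G i j with <-cmp i j
... | tri< i<j i≢j i≯j
  rewrite dec-true (i <? j) i<j | dec-false (j <? i) i≯j | dec-false (i ≟ j) i≢j with adj G i j
...   | true  = refl
...   | false = refl
trichotomy-count G i .i | tri≈ i≮i refl _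
  rewrite dec-false (i <? i) i≮i | dec-true (i ≟ i) refl = refl
trichotomy-count G i j | tri> i≮j i≢j j<i
  rewrite dec-false (i <? j) i≮j | dec-true (j <? i) j<i | dec-false (i ≟ j) i≢j
        | Graph.sym G j i with adj G i j
...   | true  = refl
...   | false = refl

-- Double counting of ordered pairs: exchanging the two summations makes the downward pairs of
-- adjacent vertices a second copy of `size G`. The additive form avoids truncated subtraction.
size-compl : (G : FinGraph n) → size G + size G + (degreeSum (compl G) + n) ≡ n * n
size-compl {n} G = begin
  size G + size G + (degreeSum (compl G) + n)
    ≡⟨ cong₂ (λ a b → size G + a + (degreeSum (compl G) + b)) (∑-comm A)
         (sym (sum-ones sum-δ)) ⟩
  ∑∑ A + ∑∑ (flip A) + (∑∑ B + ∑∑ δ)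
    ≡⟨ cong₂ _+_ (sym (∑∑-+ A (flip A))) (sym (∑∑-+ B δ)) ⟩
  ∑∑ (λ i j → A i j + A j i) + ∑∑ (λ i j → B i j + δ i j)
    ≡⟨ sym (∑∑-+ _ _) ⟩
  ∑∑ (λ i j → A i j + A j i + (B i j + δ i j))
    ≡⟨ sum-cong-≗ (λ i → sum-ones (trichotomy-count G i)) ⟩
  ∑[ i < n ] n
    ≡⟨ sum-const n n ⟩
  n * n ∎
  where
  open ≡-Reasoning
  ∑∑ : (Fin n → Fin n → ℕ) → ℕ
  ∑∑ f = ∑[ i < n ] ∑[ j < n ] f i j
  ∑∑-+ : ∀ f g → ∑∑ (λ i j → f i j + g i j) ≡ ∑∑ f + ∑∑ g
  ∑∑-+ f g = trans (sum-cong-≗ λ i → ∑-distrib-+ (f i) (g i))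
                      (∑-distrib-+ (λ i → sum (f i)) (λ i → sum (g i)))
  A B : Fin n → Fin n → ℕ
  A i j = indicator (does (i <? j) ∧ adj G i j)
  B i j = indicator (adj (compl G) i j)

-- Graphs consisting of a core L and a perfect matching of the other vertices

Join : FinGraph s → ∀ r → Graph (Fin s ⊎ (Fin r ⊎ Fin r))
Join {s} L r = record { adj = adjacent ; sym = symm ; irrefl = irr }
  where
  adjacent : Fin s ⊎ (Fin r ⊎ Fin r) → Fin s ⊎ (Fin r ⊎ Fin r) → Bool
  adjacent (inj₁ t)        (inj₁ u)        = adj L t u
  adjacent (inj₁ _)        (inj₂ _)        = false
  adjacent (inj₂ _)        (inj₁ _)        = false
  adjacent (inj₂ (inj₁ a)) (inj₂ (inj₂ b)) = does (a ≟ b)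
  adjacent (inj₂ (inj₂ a)) (inj₂ (inj₁ b)) = does (b ≟ a)
  adjacent (inj₂ (inj₁ _)) (inj₂ (inj₁ _)) = false
  adjacent (inj₂ (inj₂ _)) (inj₂ (inj₂ _)) = false

  symm : ∀ u v → adjacent u v ≡ adjacent v u
  symm (inj₁ t)        (inj₁ u)        = Graph.sym L t u
  symm (inj₂ (inj₁ a)) (inj₂ (inj₂ b)) = refl
  symm (inj₂ (inj₂ a)) (inj₂ (inj₁ b)) = refl
  symm (inj₂ (inj₁ _)) (inj₂ (inj₁ _)) = refl
  symm (inj₂ (inj₂ _)) (inj₂ (inj₂ _)) = refl
  symm (inj₁ _)        (inj₂ _)        = refl
  symm (inj₂ _)        (inj₁ _)        = refl

  irr : ∀ v → adjacent v v ≡ false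
  irr (inj₁ t)        = Graph.irrefl L t
  irr (inj₂ (inj₁ _)) = refl
  irr (inj₂ (inj₂ _)) = refl

-- A description of the graphs `Join L r` from inside C, with neither `r` nor a bijection: it can be
-- checked from degrees and closure alone. `core-closed` separates the core from the rest, and
-- `matched` makes the rest a perfect matching.
record Splits (L : FinGraph s) (C : FinGraph n) : Set where
  field
    core           : Fin s → Fin n
    core-injective : ∀ {t u} → core t ≡ core u → t ≡ u
    core-adj       : ∀ t u → adj C (core t) (core u) ≡ adj L t u
    core-closed    : ∀ {t j} → adj C (core t) j ≡ true → ∃ λ u → core u ≡ j
    matched        : ∀ {i} → ¬ (∃ λ t → core t ≡ i) → ∃! _≡_ λ j → adj C i j ≡ true

  core? : ∀ i → Dec (∃ λ t → core t ≡ i)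
  core? i = any? λ t → core t ≟ i

≅Join⇒Splits : {L : FinGraph s} {C : FinGraph n} → C ≅ Join L r → Splits L C
≅Join⇒Splits {s} {n} {r} {L} {C} φ = record
  { core           = from ∘ inj₁
  ; core-injective = λ eq → Sum.inj₁-injective (from-injective eq)
  ; core-adj       = λ t u → adj-from (inj₁ t) (inj₁ u)
  ; core-closed    = λ {t} {j} → closed t j
  ; matched        = λ {i} → match i
  }
  where
  open Inverse (_≅_.bijection φ)
  from-injective : ∀ {a b} → from a ≡ from b → a ≡ b
  from-injective {a} {b} eq =
    trans (sym (strictlyInverseˡ a)) (trans (cong to eq) (strictlyInverseˡ b))
  adj-from : ∀ a b → adj C (from a) (from b) ≡ adj (Join L r) a b
  adj-from a b = trans (_≅_.adj-cong φ _ _)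
    (cong₂ (adj (Join L r)) (strictlyInverseˡ a) (strictlyInverseˡ b))
  adj-to : ∀ {a j} → adj C (from a) j ≡ true → adj (Join L r) a (to j) ≡ true
  adj-to {a} {j} e = trans (sym (adj-from a (to j))) (trans (cong (adj C (from a)) (strictlyInverseʳ j)) e)
  closed : ∀ t j → adj C (from (inj₁ t)) j ≡ true → ∃ λ u → from (inj₁ u) ≡ j
  closed t j e with to j in eq | adj-to e
  ... | inj₁ u | _  = u , trans (cong from (sym eq)) (strictlyInverseʳ j)
  ... | inj₂ _ | ()
  partner : Fin r ⊎ Fin r → Fin r ⊎ Fin r
  partner = Sum.swap
  partner-adj : ∀ y → adj (Join L r) (inj₂ y) (inj₂ (partner y)) ≡ true
  partner-adj (inj₁ a) = dec-true (a ≟ a) refl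
  partner-adj (inj₂ a) = dec-true (a ≟ a) refl
  partner-unique : ∀ y z → adj (Join L r) (inj₂ y) z ≡ true → inj₂ (partner y) ≡ z
  partner-unique (inj₁ a) (inj₂ (inj₂ b)) e = cong (inj₂ ∘ inj₂) (does-true (a ≟ b) e)
  partner-unique (inj₂ a) (inj₂ (inj₁ b)) e = cong (inj₂ ∘ inj₁) (sym (does-true (b ≟ a) e))
  match : ∀ i → ¬ (∃ λ t → from (inj₁ t) ≡ i) → ∃! _≡_ λ j → adj C i j ≡ true
  match i ¬core with to i in eq
  ... | inj₁ t = contradiction (t , trans (cong from (sym eq)) (strictlyInverseʳ i)) ¬core
  ... | inj₂ y with refl ← trans (cong from (sym eq)) (strictlyInverseʳ i) =
    from (inj₂ (partner y)) , trans (adj-from _ _) (partner-adj y) ,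
    λ {j} e → trans (cong from (partner-unique y (to j) (adj-to e))) (strictlyInverseʳ j)

-- A matched pair is oriented by the order on Fin n; this splits the vertices
-- outside the core into the two sides of the matching.
Splits⇒≅Join : {L : FinGraph s} {C : FinGraph n} → Splits L C → ∃ λ r → C ≅ Join L r
Splits⇒≅Join {s} {n} {L} {C} S = count isLower , ≅-sym (record
  { bijection = injective∧surjective⇒↔ place place-injective place-surjective
  ; adj-cong  = λ a b → sym (adj-place a b) })
  where
  open Splits S
  Core : Fin n → Set
  Core i = ∃ λ t → core t ≡ i
  Lower : Fin n → Set
  Lower i = ¬ Core i × ∃ λ k → adj C i k ≡ true × i Fin.< k
  lower? : ∀ i → Dec (Lower i)
  lower? i = ¬? (core? i) ×-dec any? λ k → (adj C i k Bool.≟ true) ×-dec (i <? k)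
  isLower : Fin n → Bool
  isLower i = does (lower? i)
  R : Set
  R = Fin (count isLower)
  module E = Inverse (enumerate isLower)

  unique : ∀ {i j k} → ¬ Core i → adj C i j ≡ true → adj C i k ≡ true → j ≡ k
  unique ¬c ij ik = trans (sym (proj₂ (proj₂ (matched ¬c)) ij)) (proj₂ (proj₂ (matched ¬c)) ik)
  outside : ∀ {i j} → ¬ Core i → adj C i j ≡ true → ¬ Core j
  outside ¬c ij (t , refl) = ¬c (core-closed (symmetric {G = C} ij))

  lo hi : R → Fin n
  lo a = proj₁ (E.to a)
  lo-Lower : ∀ a → Lower (lo a)
  lo-Lower a = does-true (lower? (lo a)) (proj₂ (E.to a))
  hi a = proj₁ (proj₂ (lo-Lower a))
  lo-outside : ∀ a → ¬ Core (lo a)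
  lo-outside a = proj₁ (lo-Lower a)
  lo~hi : ∀ a → adj C (lo a) (hi a) ≡ true
  lo~hi a = proj₁ (proj₂ (proj₂ (lo-Lower a)))
  hi~lo : ∀ a → adj C (hi a) (lo a) ≡ true
  hi~lo a = symmetric {G = C} (lo~hi a)
  lo<hi : ∀ a → lo a Fin.< hi a
  lo<hi a = proj₂ (proj₂ (proj₂ (lo-Lower a)))
  hi-outside : ∀ a → ¬ Core (hi a)
  hi-outside a = outside (lo-outside a) (lo~hi a)
  lo-injective : ∀ {a b} → lo a ≡ lo b → a ≡ b
  lo-injective {a} {b} eq = trans (sym (E.strictlyInverseʳ a))
    (trans (cong E.from (support-≡ {f = isLower} eq)) (E.strictlyInverseʳ b))
  lo-onto : ∀ {i} → Lower i → ∃ λ a → lo a ≡ i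
  lo-onto {i} l = E.from x , cong proj₁ (E.strictlyInverseˡ x)
    where x = i , dec-true (lower? i) l

  place : Fin s ⊎ (R ⊎ R) → Fin n
  place (inj₁ t)        = core t
  place (inj₂ (inj₁ a)) = lo a
  place (inj₂ (inj₂ a)) = hi a

  place-outside : ∀ y → ¬ Core (place (inj₂ y))
  place-outside (inj₁ a) = lo-outside a
  place-outside (inj₂ a) = hi-outside a

  -- Adjacent lower vertices would be each other's partners, so each would precede the other.
  lo≁lo : ∀ a b → adj C (lo a) (lo b) ≢ true
  lo≁lo a b e = ℕ.<-asym
    (subst (lo a Fin.<_) (unique (lo-outside a) (lo~hi a) e) (lo<hi a))
    (subst (lo b Fin.<_) (unique (lo-outside b) (lo~hi b) (symmetric {G = C} e)) (lo<hi b))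
  hi≁hi : ∀ a b → adj C (hi a) (hi b) ≢ true
  hi≁hi a b e = ℕ.<-asym
    (subst (Fin._< hi a) (unique (hi-outside a) (hi~lo a) e) (lo<hi a))
    (subst (Fin._< hi b) (unique (hi-outside b) (hi~lo b) (symmetric {G = C} e)) (lo<hi b))
  lo~hi⇒≡ : ∀ a b → adj C (lo a) (hi b) ≡ true → a ≡ b
  lo~hi⇒≡ a b e = lo-injective (unique (hi-outside b) (symmetric {G = C} e) (hi~lo b))

  adj-lo-hi : ∀ a b → adj C (lo a) (hi b) ≡ does (a ≟ b)
  adj-lo-hi a b = bool-ext (λ e → dec-true (a ≟ b) (lo~hi⇒≡ a b e)) back
    where
    back : does (a ≟ b) ≡ true → adj C (lo a) (hi b) ≡ true
    back e with refl ← does-true (a ≟ b) e = lo~hi a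

  adj-core-outside : ∀ t y → adj C (core t) (place (inj₂ y)) ≡ false
  adj-core-outside t y = ≢true⇒false (place-outside y ∘ core-closed)

  adj-place : ∀ a b → adj C (place a) (place b) ≡ adj (Join L (count isLower)) a b
  adj-place (inj₁ t)        (inj₁ u)        = core-adj t u
  adj-place (inj₁ t)        (inj₂ y)        = adj-core-outside t y
  adj-place (inj₂ y)        (inj₁ t)        =
    trans (Graph.sym C (place (inj₂ y)) (core t)) (adj-core-outside t y)
  adj-place (inj₂ (inj₁ a)) (inj₂ (inj₁ b)) = ≢true⇒false (lo≁lo a b)
  adj-place (inj₂ (inj₁ a)) (inj₂ (inj₂ b)) = adj-lo-hi a b
  adj-place (inj₂ (inj₂ a)) (inj₂ (inj₁ b)) = trans (Graph.sym C (hi a) (lo b)) (adj-lo-hi b a)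
  adj-place (inj₂ (inj₂ a)) (inj₂ (inj₂ b)) = ≢true⇒false (hi≁hi a b)

  place-injective : ∀ {a b} → place a ≡ place b → a ≡ b
  place-injective {inj₁ t}        {inj₁ u}        eq = cong inj₁ (core-injective eq)
  place-injective {inj₁ t}        {inj₂ y}        eq = contradiction (t , eq) (place-outside y)
  place-injective {inj₂ y}        {inj₁ t}        eq = contradiction (t , sym eq) (place-outside y)
  place-injective {inj₂ (inj₁ a)} {inj₂ (inj₁ b)} eq = cong (inj₂ ∘ inj₁) (lo-injective eq)
  place-injective {inj₂ (inj₁ a)} {inj₂ (inj₂ b)} eq =
    contradiction (subst (λ i → adj C (lo b) i ≡ true) (sym eq) (lo~hi b)) (lo≁lo b a)
  place-injective {inj₂ (inj₂ a)} {inj₂ (inj₁ b)} eq =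
    contradiction (subst (λ i → adj C (lo a) i ≡ true) eq (lo~hi a)) (lo≁lo a b)
  place-injective {inj₂ (inj₂ a)} {inj₂ (inj₂ b)} eq =
    cong (inj₂ ∘ inj₂) (lo~hi⇒≡ a b (subst (λ i → adj C (lo a) i ≡ true) eq (lo~hi a)))

  place-surjective : ∀ i → ∃ λ a → place a ≡ i
  place-surjective i with core? i
  ... | yes (t , eq) = inj₁ t , eq
  ... | no ¬c with matched ¬c
  ...   | k , ik , _ with <-cmp i k
  ...     | tri< i<k _ _ = let a , eq = lo-onto (¬c , k , ik , i<k) in inj₂ (inj₁ a) , eq
  -- If the partner `k` is the smaller one, then `k` is some `lo a`, and uniqueness of partners
  -- makes `i` equal to `hi a`.
  ...     | tri≈ _ i≡k _ = contradiction i≡k (irreflexive {G = C} ik)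
  ...     | tri> _ _ k<i
    with lo-onto (outside ¬c ik , i , symmetric {G = C} ik , k<i)
  ...       | a , refl = inj₂ (inj₂ a) , unique (lo-outside a) (lo~hi a) (symmetric {G = C} ik)

parts : ∀ s r → Fin (s + (r + r)) ↔ (Fin s ⊎ (Fin r ⊎ Fin r))
parts s r = ↔-trans (Fin.+↔⊎ {s} {r + r}) (↔-refl ⊎-↔ Fin.+↔⊎ {r} {r})

-- The order n = s + 2r determines r, so both graphs are isomorphic to the same `Join L r`.
splits-unique : {L : FinGraph s} {C D : FinGraph n} → Splits L C → Splits L D → C ≅ D
splits-unique {s} {n} {L} {C} {D} S T with Splits⇒≅Join S | Splits⇒≅Join T
... | r , φ | r′ , ψ = ≅-trans φ (subst (λ k → Join L k ≅ D) (sym r≡r′) (≅-sym ψ))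
  where
  order : ∀ {k} {E : FinGraph n} → E ≅ Join L k → n ≡ s + (k + k)
  order χ = ↔⇒≡ (↔-trans (_≅_.bijection χ) (↔-sym (parts s _)))
  r≡r′ : r ≡ r′
  r≡r′ = trans (ℕ.n≡⌊n+n/2⌋ r) (trans
    (cong ⌊_/2⌋ (ℕ.+-cancelˡ-≡ s _ _ (trans (sym (order φ)) (order ψ)))) (sym (ℕ.n≡⌊n+n/2⌋ r′)))

-- The structure is prescribed for the complement, so the witness is itself a complement, and
-- complementing twice gives back the join.
splits-exists : (L : FinGraph s) (r : ℕ) → n ≡ s + (r + r) → ∃ λ (G : FinGraph n) → Splits L (compl G)
splits-exists {s} L r refl = compl C , ≅Join⇒Splits
  (≅-trans (compl-compl C) (pullback-≅ (parts s r) (Join L r)))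
  where
  C : FinGraph (s + (r + r))
  C = pullback (Inverse.to (parts s r)) (Join L r)

-- Vertex by vertex: one neighbour each, except that core t has degree L t of them.
splits-degreeSum : {L : FinGraph s} {C : FinGraph n} → Splits L C →
                   degreeSum C + s ≡ n + degreeSum L
splits-degreeSum {s} {n} {L} {C} S = begin
  degreeSum C + s
    ≡⟨ cong (degreeSum C +_) (sym (trans (sum-over-core (λ _ → 1)) (sum-ones {s} λ _ → refl))) ⟩
  degreeSum C + ∑[ i < n ] spread (λ _ → 1) i
    ≡⟨ sym (∑-distrib-+ (degree C) (spread λ _ → 1)) ⟩
  ∑[ i < n ] (degree C i + spread (λ _ → 1) i)
    ≡⟨ sum-cong-≗ pointwise ⟩
  ∑[ i < n ] (1 + spread (degree L) i)
    ≡⟨ ∑-distrib-+ (λ _ → 1) (spread (degree L)) ⟩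
  ∑[ i < n ] 1 + ∑[ i < n ] spread (degree L) i
    ≡⟨ cong₂ _+_ (sum-ones {n} λ _ → refl) (sum-over-core (degree L)) ⟩
  n + degreeSum L ∎
  where
  open ≡-Reasoning
  open Splits S
  -- Transports weights from the core to all vertices, with value 0 outside, so that sums over
  -- `Fin s` and over `Fin n` can be compared.
  spread : (Fin s → ℕ) → Fin n → ℕ
  spread w i = ∑[ t < s ] (w t * δ (core t) i)
  δ-core : ∀ t u → δ (core t) (core u) ≡ δ t u
  δ-core t u with t ≟ u
  ... | yes refl = δ-same (core t)
  ... | no  t≢u  = δ-diff (t≢u ∘ core-injective)
  spread-core : ∀ w t → spread w (core t) ≡ w t
  spread-core w t = trans (sum-cong-≗ λ u → cong (w u *_) (δ-core u t)) (sum-select w t)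
  spread-outside : ∀ w {i} → ¬ (∃ λ t → core t ≡ i) → spread w i ≡ 0
  spread-outside w ¬c = sum-zeros {s} λ t →
    trans (cong (w t *_) (δ-diff λ eq → ¬c (t , eq))) (ℕ.*-zeroʳ (w t))
  sum-over-core : ∀ w → ∑[ i < n ] spread w i ≡ sum w
  sum-over-core w = trans (∑-comm λ i t → w t * δ (core t) i) (sum-cong-≗ λ t →
    trans (sum-scale (w t) (δ (core t))) (trans (cong (w t *_) (sum-δ (core t))) (ℕ.*-identityʳ (w t))))
  adj-spread : ∀ t j → indicator (adj C (core t) j) ≡ spread (indicator ∘ adj L t) j
  adj-spread t j with core? j
  ... | yes (u , refl) = trans (cong indicator (core-adj t u)) (sym (spread-core (indicator ∘ adj L t) u))
  ... | no ¬c = trans (cong indicator (≢true⇒false (¬c ∘ core-closed)))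
                                (sym (spread-outside (indicator ∘ adj L t) ¬c))
  degree-core : ∀ t → degree C (core t) ≡ degree L t
  degree-core t = trans (sum-cong-≗ (adj-spread t)) (sum-over-core (indicator ∘ adj L t))
  degree-outside : ∀ {i} → ¬ (∃ λ t → core t ≡ i) → degree C i ≡ 1
  degree-outside {i} ¬c with matched ¬c
  ... | k , ik , k-only = ℕ.≤-antisym
    (count-≤-length (k ∷ []) λ j ij → here (sym (k-only ij)))
    (length-≤-count {f = adj C i} ([] ∷ []) (ik ∷ []))
  pointwise : ∀ i → degree C i + spread (λ _ → 1) i ≡ 1 + spread (degree L) i
  pointwise i with core? i
  ... | yes (t , refl) = trans (cong₂ _+_ (trans (degree-core t) (sym (spread-core (degree L) t)))
                                          (spread-core (λ _ → 1) t)) (ℕ.+-comm _ 1)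
  ... | no ¬c = trans (cong₂ _+_ (degree-outside ¬c) (spread-outside (λ _ → 1) ¬c))
                      (cong suc (sym (spread-outside (degree L) ¬c)))

-- Copies of the book

private variable
  G : FinGraph n
  K : Subset n
  u v z u′ v′ z′ : Fin n

IsEnd : {V : Set} → V → V → V → Set
IsEnd u v i = i ≡ u ⊎ i ≡ v

BookEdge : Subset n → Fin n → Fin n → Fin n → Fin n → Set
BookEdge K u v i j = i ∈ₛ K × j ∈ₛ K × i ≢ j × (IsEnd u v i ⊎ IsEnd u v j)

isEnd? : (u v i : Fin n) → Dec (IsEnd u v i)
isEnd? u v i = (i ≟ u) ⊎-dec (i ≟ v)

bookEdge? : (K : Subset n) (u v i j : Fin n) → Dec (BookEdge K u v i j)
bookEdge? K u v i j =
  (i ∈ₛ? K) ×-dec (j ∈ₛ? K) ×-dec ¬? (i ≟ j) ×-dec (isEnd? u v i ⊎-dec isEnd? u v j)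

-- Stating `full` as non-adjacency in the complement lets `j` be `i` itself, since the complement
-- has no loops.
record Spine (G : FinGraph n) (K : Subset n) (u v : Fin n) : Set where
  field
    distinct : u ≢ v
    u∈K      : u ∈ₛ K
    v∈K      : v ∈ₛ K
    full     : ∀ {i j} → IsEnd u v i → j ∈ₛ K → adj (compl G) i j ≡ false

-- The edge set depends only on the vertex set and the unordered spine, so comparing copies amounts
-- to comparing these two.
record IsBook {G : FinGraph n} (S : Subgraph G) (u v : Fin n) : Set where
  field
    spine : Spine G (vertices S) u v
    edges : ∀ i j → edge S i j ≡ true ⇔ BookEdge (vertices S) u v i j

BookEnd : Fin 2 ⊎ Fin p → Set
BookEnd = IsEnd (inj₁ 0F) (inj₁ 1F)

-- This form of adjacency does not mention the labels of the pages, so it carries over to `BookEdge`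
-- along any injection.
book-adj⇒ : (a b : Fin 2 ⊎ Fin p) → adj (Book p) a b ≡ true → a ≢ b × (BookEnd a ⊎ BookEnd b)
book-adj⇒ (inj₁ 0F) (inj₁ 1F) _ = (λ ()) , inj₁ (inj₁ refl)
book-adj⇒ (inj₁ 1F) (inj₁ 0F) _ = (λ ()) , inj₁ (inj₂ refl)
book-adj⇒ (inj₁ 1F) (inj₁ 1F) ()
book-adj⇒ (inj₁ 0F) (inj₂ _)  _ = (λ ()) , inj₁ (inj₁ refl)
book-adj⇒ (inj₁ 1F) (inj₂ _)  _ = (λ ()) , inj₁ (inj₂ refl)
book-adj⇒ (inj₂ _)  (inj₁ 0F) _ = (λ ()) , inj₂ (inj₁ refl)
book-adj⇒ (inj₂ _)  (inj₁ 1F) _ = (λ ()) , inj₂ (inj₂ refl)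

book-adj⇐ : (a b : Fin 2 ⊎ Fin p) → a ≢ b → BookEnd a ⊎ BookEnd b → adj (Book p) a b ≡ true
book-adj⇐ (inj₁ 0F) (inj₁ 1F) _   _ = refl
book-adj⇐ (inj₁ 1F) (inj₁ 0F) _   _ = refl
book-adj⇐ (inj₁ 0F) (inj₁ 0F) a≢a _ = contradiction refl a≢a
book-adj⇐ (inj₁ 1F) (inj₁ 1F) a≢a _ = contradiction refl a≢a
book-adj⇐ (inj₁ 0F) (inj₂ _)  _   _ = refl
book-adj⇐ (inj₁ 1F) (inj₂ _)  _   _ = refl
book-adj⇐ (inj₂ _)  (inj₁ 0F) _   _ = refl
book-adj⇐ (inj₂ _)  (inj₁ 1F) _   _ = refl
book-adj⇐ (inj₂ _)  (inj₂ _)  _   (inj₁ (inj₁ ()))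
book-adj⇐ (inj₂ _)  (inj₂ _)  _   (inj₁ (inj₂ ()))
book-adj⇐ (inj₂ _)  (inj₂ _)  _   (inj₂ (inj₁ ()))
book-adj⇐ (inj₂ _)  (inj₂ _)  _   (inj₂ (inj₂ ()))

member-≡ : {x y : ∃ (_∈ₛ K)} → proj₁ x ≡ proj₁ y → x ≡ y
member-≡ {x = i , m} {.i , m′} refl = cong (i ,_) ([]=-irrelevant m m′)

∈-support : (K : Subset n) → (∃ λ i → lookup K i ≡ true) ↔ ∃ (_∈ₛ K)
∈-support K = mk↔ₛ′
  (λ (i , e) → i , lookup⇒[]= i K e)
  (λ (i , m) → i , []=⇒lookup m)
  (λ _ → member-≡ refl)
  (λ (i , e) → support-≡ {f = lookup K} refl)

-- Replaces an abstract isomorphism by concrete data: the images of the two spine vertices, and the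
-- number of vertices found by composing bijections.
copy⇒book : {S : Subgraph G} → IsCopy (Book p) S →
            ∃₂ (IsBook S) × count (lookup (vertices S)) ≡ p + 2
copy⇒book {n} {G = G} {p} {S} φ = (at (inj₁ 0F) , at (inj₁ 1F) , record
    { spine = record
      { distinct = λ eq → contradiction (at-injective eq) λ ()
      ; u∈K      = at-∈ (inj₁ 0F)
      ; v∈K      = at-∈ (inj₁ 1F)
      ; full     = full }
    ; edges = λ i j → mk⇔ (edge⇒ i j) (edge⇐ i j) })
  , trans (↔⇒≡ (↔-trans (enumerate (lookup P)) (↔-trans (∈-support P)
            (↔-trans (↔-sym (_≅_.bijection φ)) (↔-sym (Fin.+↔⊎ {2} {p})))))) (ℕ.+-comm 2 p)
  where
  open Inverse (_≅_.bijection φ)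
  P : Subset n
  P = vertices S
  at : Fin 2 ⊎ Fin p → Fin n
  at a = proj₁ (to a)
  at-∈ : ∀ a → at a ∈ₛ P
  at-∈ a = proj₂ (to a)
  at-injective : ∀ {a b} → at a ≡ at b → a ≡ b
  at-injective {a} {b} eq = trans (sym (strictlyInverseʳ a))
    (trans (cong from (member-≡ eq)) (strictlyInverseʳ b))
  at-onto : ∀ {i} → i ∈ₛ P → ∃ λ a → at a ≡ i
  at-onto i∈K = from (_ , i∈K) , cong proj₁ (strictlyInverseˡ (_ , i∈K))
  isEnd⇒ : ∀ {a} → BookEnd a → IsEnd (at (inj₁ 0F)) (at (inj₁ 1F)) (at a)
  isEnd⇒ = Sum.map (cong at) (cong at)
  isEnd⇐ : ∀ {a} → IsEnd (at (inj₁ 0F)) (at (inj₁ 1F)) (at a) → BookEnd a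
  isEnd⇐ = Sum.map at-injective at-injective
  edge⇒ : ∀ i j → edge S i j ≡ true → BookEdge P (at (inj₁ 0F)) (at (inj₁ 1F)) i j
  edge⇒ i j e with Subgraph.edge⇒∈ S i j e
  ... | i∈K , j∈K with at-onto i∈K | at-onto j∈K
  ...   | a , refl | b , refl with book-adj⇒ a b (trans (_≅_.adj-cong φ a b) e)
  ...     | a≢b , end = i∈K , j∈K , a≢b ∘ at-injective , Sum.map isEnd⇒ isEnd⇒ end
  edge⇐ : ∀ i j → BookEdge P (at (inj₁ 0F)) (at (inj₁ 1F)) i j → edge S i j ≡ true
  edge⇐ i j (i∈K , j∈K , i≢j , end) with at-onto i∈K | at-onto j∈K
  ... | a , refl | b , refl = trans (sym (_≅_.adj-cong φ a b))
    (book-adj⇐ a b (i≢j ∘ cong at) (Sum.map isEnd⇐ isEnd⇐ end))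
  full : ∀ {i j} → IsEnd (at (inj₁ 0F)) (at (inj₁ 1F)) i → j ∈ₛ P → adj (compl G) i j ≡ false
  full {i} {j} end j∈K with i ≟ j
  ... | yes refl = refl
  ... | no  i≢j  = cong not (Subgraph.edge⇒adj S i j (edge⇐ i j (i∈K end , j∈K , i≢j , inj₁ end)))
    where
    i∈K : ∀ {i} → IsEnd (at (inj₁ 0F)) (at (inj₁ 1F)) i → i ∈ₛ P
    i∈K (inj₁ refl) = at-∈ (inj₁ 0F)
    i∈K (inj₂ refl) = at-∈ (inj₁ 1F)

bookSubgraph : Spine G K u v → Subgraph G
bookSubgraph {G = G} {K} {u} {v} σ = record
  { vertices = K
  ; edge     = λ i j → does (bookEdge? K u v i j)
  ; edge-sym = λ i j → bool-ext (flipped i j) (flipped j i)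
  ; edge⇒∈   = λ i j e → let i∈K , j∈K , _ = does-true (bookEdge? K u v i j) e in i∈K , j∈K
  ; edge⇒adj = λ i j e → adjacent (does-true (bookEdge? K u v i j) e) }
  where
  open Spine σ
  flipped : ∀ i j → does (bookEdge? K u v i j) ≡ true → does (bookEdge? K u v j i) ≡ true
  flipped i j e with does-true (bookEdge? K u v i j) e
  ... | i∈K , j∈K , i≢j , end =
    dec-true (bookEdge? K u v j i) (j∈K , i∈K , i≢j ∘ sym , Sum.swap end)
  from-end : ∀ {i j} → IsEnd u v i → j ∈ₛ K → i ≢ j → adj G i j ≡ true
  from-end end j∈K i≢j = Bool.not-injective (trans (sym (compl-≢ G i≢j)) (full end j∈K))
  adjacent : ∀ {i j} → BookEdge K u v i j → adj G i j ≡ true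
  adjacent (i∈K , j∈K , i≢j , inj₁ end) = from-end end j∈K i≢j
  adjacent (i∈K , j∈K , i≢j , inj₂ end) = symmetric {G = G} (from-end end i∈K (i≢j ∘ sym))

bookSubgraph-isBook : (σ : Spine G K u v) → IsBook (bookSubgraph σ) u v
bookSubgraph-isBook {K = K} {u} {v} σ = record
  { spine = σ
  ; edges = λ i j → mk⇔ (does-true (bookEdge? K u v i j)) (dec-true (bookEdge? K u v i j)) }

-- Removing the two ends from `K` leaves p vertices; their enumeration labels the pages.
bookSubgraph-isCopy : (σ : Spine G K u v) → count (lookup K) ≡ p + 2 → IsCopy (Book p) (bookSubgraph σ)
bookSubgraph-isCopy {n} {G = G} {K} {u} {v} {p} σ |K| = record
  { bijection = injective∧surjective⇒↔ place (at-injective ∘ cong proj₁) place-surjective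
  ; adj-cong  = λ a b → bool-ext (adj⇒ a b) (adj⇐ a b) }
  where
  open Spine σ
  isPage : Fin n → Bool
  isPage i = lookup K i ∧ not (does (isEnd? u v i))
  pages-pointwise : ∀ i → indicator (isPage i) + (δ u i + δ v i) ≡ indicator (lookup K i)
  pages-pointwise i with i ≟ u | i ≟ v
  ... | yes refl | yes refl = contradiction refl distinct
  ... | yes refl | no  i≢v rewrite []=⇒lookup u∈K | δ-same u | δ-diff (i≢v ∘ sym) = refl
  ... | no  i≢u  | yes refl rewrite []=⇒lookup v∈K | δ-same v | δ-diff (i≢u ∘ sym) = refl
  ... | no  i≢u  | no  i≢v rewrite δ-diff (i≢u ∘ sym) | δ-diff (i≢v ∘ sym) =
    trans (ℕ.+-identityʳ _) (cong indicator (Bool.∧-identityʳ (lookup K i)))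
  |pages| : count isPage ≡ p
  |pages| = ℕ.+-cancelʳ-≡ 2 _ _ (begin
    count isPage + 2
      ≡⟨ cong (count isPage +_) (sym (cong₂ _+_ (sum-δ u) (sum-δ v))) ⟩
    count isPage + (sum (δ u) + sum (δ v))
      ≡⟨ cong (count isPage +_) (sym (∑-distrib-+ (δ u) (δ v))) ⟩
    count isPage + ∑[ i < n ] (δ u i + δ v i)
      ≡⟨ sym (∑-distrib-+ (indicator ∘ isPage) (λ i → δ u i + δ v i)) ⟩
    ∑[ i < n ] (indicator (isPage i) + (δ u i + δ v i))
      ≡⟨ sum-cong-≗ pages-pointwise ⟩
    count (lookup K)
      ≡⟨ |K| ⟩
    p + 2 ∎)
    where open ≡-Reasoning
  module E = Inverse (subst (λ m → Fin m ↔ ∃ λ i → isPage i ≡ true) |pages| (enumerate isPage))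
  page⇒ : ∀ i → isPage i ≡ true → i ∈ₛ K × ¬ IsEnd u v i
  page⇒ i e = lookup⇒[]= i K (Bool.∧-conicalˡ _ _ e) ,
    λ end → contradiction (cong not (dec-true (isEnd? u v i) end))
      (true≢false (Bool.∧-conicalʳ (lookup K i) _ e))
  page⇐ : ∀ i → i ∈ₛ K → ¬ IsEnd u v i → isPage i ≡ true
  page⇐ i i∈K ¬end = cong₂ _∧_ ([]=⇒lookup i∈K) (cong not (dec-false (isEnd? u v i) ¬end))
  place : Fin 2 ⊎ Fin p → ∃ (_∈ₛ K)
  place (inj₁ 0F) = u , u∈K
  place (inj₁ 1F) = v , v∈K
  place (inj₂ q)  = proj₁ (E.to q) , proj₁ (page⇒ _ (proj₂ (E.to q)))
  at : Fin 2 ⊎ Fin p → Fin n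
  at a = proj₁ (place a)
  page-¬end : ∀ q → ¬ IsEnd u v (at (inj₂ q))
  page-¬end q = proj₂ (page⇒ _ (proj₂ (E.to q)))
  at-injective : ∀ {a b} → at a ≡ at b → a ≡ b
  at-injective {inj₁ 0F} {inj₁ 0F} _  = refl
  at-injective {inj₁ 0F} {inj₁ 1F} eq = contradiction eq distinct
  at-injective {inj₁ 1F} {inj₁ 0F} eq = contradiction (sym eq) distinct
  at-injective {inj₁ 1F} {inj₁ 1F} _  = refl
  at-injective {inj₁ 0F} {inj₂ q}  eq = contradiction (inj₁ (sym eq)) (page-¬end q)
  at-injective {inj₁ 1F} {inj₂ q}  eq = contradiction (inj₂ (sym eq)) (page-¬end q)
  at-injective {inj₂ q}  {inj₁ 0F} eq = contradiction (inj₁ eq) (page-¬end q)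
  at-injective {inj₂ q}  {inj₁ 1F} eq = contradiction (inj₂ eq) (page-¬end q)
  at-injective {inj₂ q}  {inj₂ q′} eq = cong inj₂ (trans (sym (E.strictlyInverseʳ q))
    (trans (cong E.from (support-≡ {f = isPage} eq)) (E.strictlyInverseʳ q′)))
  place-surjective : ∀ x → ∃ λ a → place a ≡ x
  place-surjective (i , i∈K) = let a , eq = preimage in a , member-≡ eq
    where
    preimage : ∃ λ a → at a ≡ i
    preimage with isEnd? u v i
    ... | yes (inj₁ i≡u) = inj₁ 0F , sym i≡u
    ... | yes (inj₂ i≡v) = inj₁ 1F , sym i≡v
    ... | no  ¬end       = inj₂ (E.from x) , cong proj₁ (E.strictlyInverseˡ x)
      where x = i , page⇐ i i∈K ¬end
  adj⇒ : ∀ a b → adj (Book p) a b ≡ true → does (bookEdge? K u v (at a) (at b)) ≡ true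
  adj⇒ a b e = let a≢b , end = book-adj⇒ a b e in dec-true (bookEdge? K u v (at a) (at b))
    (proj₂ (place a) , proj₂ (place b) , a≢b ∘ at-injective ,
     Sum.map (Sum.map (cong at) (cong at)) (Sum.map (cong at) (cong at)) end)
  adj⇐ : ∀ a b → does (bookEdge? K u v (at a) (at b)) ≡ true → adj (Book p) a b ≡ true
  adj⇐ a b e = let _ , _ , at≢ , end = does-true (bookEdge? K u v (at a) (at b)) e in
    book-adj⇐ a b (at≢ ∘ cong at)
      (Sum.map (Sum.map at-injective at-injective) (Sum.map at-injective at-injective) end)

isEnd-exhaust : {V : Set} {a b a′ b′ i : V} → a′ ≢ b′ → IsEnd a b a′ → IsEnd a b b′ →
                IsEnd a b i → IsEnd a′ b′ i
isEnd-exhaust a′≢b′ (inj₁ refl) (inj₁ refl) _   = contradiction refl a′≢b′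
isEnd-exhaust a′≢b′ (inj₂ refl) (inj₂ refl) _   = contradiction refl a′≢b′
isEnd-exhaust _     (inj₁ refl) (inj₂ refl) end = end
isEnd-exhaust _     (inj₂ refl) (inj₁ refl) end = Sum.swap end

same-spine⇒≈ : {S T : Subgraph G} → IsBook S u v → IsBook T u′ v′ → vertices S ≡ vertices T →
               IsEnd u v u′ → IsEnd u v v′ → S ≈ T
same-spine⇒≈ {u = u} {v} {u′} {v′} {S} {T} B B′ refl u′-end v′-end =
  refl , λ i j → bool-ext
    (λ e → let i∈ , j∈ , i≢j , end = to (IsBook.edges B i j) e in
       from (IsBook.edges B′ i j) (i∈ , j∈ , i≢j , Sum.map forth forth end))
    (λ e → let i∈ , j∈ , i≢j , end = to (IsBook.edges B′ i j) e in
       from (IsBook.edges B i j) (i∈ , j∈ , i≢j , Sum.map back back end))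
  where
  open Equivalence
  forth : ∀ {i} → IsEnd u v i → IsEnd u′ v′ i
  forth = isEnd-exhaust (Spine.distinct (IsBook.spine B′)) u′-end v′-end
  back : ∀ {i} → IsEnd u′ v′ i → IsEnd u v i
  back (inj₁ refl) = u′-end
  back (inj₂ refl) = v′-end

-- A fourth vertex w of the book tells its spine from its pages: w is adjacent to
-- both ends of the spine, but not to a page unless w is itself an end.
≈⇒same-spine : {S T : Subgraph G} → IsBook S u v → IsBook T u′ v′ → S ≈ T →
               4 ≤ count (lookup (vertices S)) → IsEnd u v u′
≈⇒same-spine {u = u} {v} {u′} {v′} {S} {T} B B′ (refl , same) 4≤|K| with isEnd? u v u′
... | yes end = end
... | no ¬end with count-witness (u ∷ v ∷ u′ ∷ []) 4≤|K|
...   | w , w∈K , w∉ with Equivalence.to (IsBook.edges B u′ w)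
        (trans (same u′ w) (Equivalence.from (IsBook.edges B′ u′ w)
          (Spine.u∈K (IsBook.spine B′) , lookup⇒[]= w _ w∈K ,
           (λ eq → w∉ (there (there (here (sym eq))))) , inj₁ (inj₁ refl))))
...     | _ , _ , _ , inj₁ end         = end
...     | _ , _ , _ , inj₂ (inj₁ refl) = contradiction (here refl) w∉
...     | _ , _ , _ , inj₂ (inj₂ refl) = contradiction (there (here refl)) w∉

-- Isolated vertices and books that span all vertices.

Isolated : FinGraph n → Fin n → Set
Isolated C i = ∀ j → adj C i j ≢ true

degree≥1 : (C : FinGraph n) {i j : Fin n} → adj C i j ≡ true → 1 ≤ degree C i
degree≥1 C {i} ij = length-≤-count {f = adj C i} ([] ∷ []) (ij ∷ [])

isolated⊎degree≥1 : (C : FinGraph n) (i : Fin n) → Isolated C i ⊎ 1 ≤ degree C i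
isolated⊎degree≥1 C i with any? (λ j → adj C i j Bool.≟ true)
... | yes (j , ij) = inj₂ (degree≥1 C ij)
... | no  none     = inj₁ λ j ij → none (j , ij)

degree≤1⇒unique : (C : FinGraph n) {i j k : Fin n} → degree C i ≤ 1 →
                  adj C i j ≡ true → adj C i k ≡ true → j ≡ k
degree≤1⇒unique C {i} {j} {k} d≤1 ij ik with j ≟ k
... | yes j≡k = j≡k
... | no  j≢k = contradiction
  (length-≤-count {f = adj C i} ((j≢k ∷ []) ∷ [] ∷ []) (ij ∷ ik ∷ [])) (ℕ.<⇒≱ (s≤s d≤1))

degree≡1⇒∃! : (C : FinGraph n) {i : Fin n} → degree C i ≡ 1 → ∃! _≡_ λ j → adj C i j ≡ true
degree≡1⇒∃! C d≡1 with count-witness [] (ℕ.≤-reflexive (sym d≡1))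
... | j , ij , _ = j , ij , degree≤1⇒unique C (ℕ.≤-reflexive d≡1) ij

isolated? : (C : FinGraph n) (i : Fin n) → Dec (Isolated C i)
isolated? C i with any? (λ j → adj C i j Bool.≟ true)
... | yes (j , ij) = no λ iso → iso j ij
... | no  none     = yes λ j ij → none (j , ij)

-- If `u` were the only isolated vertex, raising its degree by 1 would make all degrees positive, so
-- the degree sum would be at least n - 1.
two-isolated : (C : FinGraph n) → degreeSum C + 2 ≤ n →
               ∃₂ λ u v → u ≢ v × Isolated C u × Isolated C v
two-isolated {n} C Σ+2≤n with any? (isolated? C)
... | no none = contradiction (ℕ.≤-trans (ℕ.+-monoˡ-≤ 2 (sum-pos positive)) Σ+2≤n)
                              (ℕ.<⇒≱ (ℕ.m<m+n n (s≤s z≤n)))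
  where
  positive : ∀ i → 1 ≤ degree C i
  positive i with isolated⊎degree≥1 C i
  ... | inj₁ iso = contradiction (i , iso) none
  ... | inj₂ pos = pos
... | yes (u , u-iso) with any? (λ v → ¬? (u ≟ v) ×-dec isolated? C v)
...   | yes (v , u≢v , v-iso) = u , v , u≢v , u-iso , v-iso
...   | no none = contradiction (ℕ.≤-trans Σ+2≤n (subst (n ≤_) Σ-bumped (sum-pos positive)))
                                (ℕ.<⇒≱ (ℕ.+-monoʳ-< (degreeSum C) ℕ.≤-refl))
  where
  positive : ∀ i → 1 ≤ degree C i + δ u i
  positive i with u ≟ i | isolated⊎degree≥1 C i
  ... | yes _   | _        = ℕ.m≤n+m 1 (degree C i)
  ... | no  u≢i | inj₁ iso = contradiction (i , u≢i , iso) none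
  ... | no  _   | inj₂ pos = ℕ.≤-trans pos (ℕ.m≤m+n _ 0)
  Σ-bumped : ∑[ i < n ] (degree C i + δ u i) ≡ degreeSum C + 1
  Σ-bumped = trans (∑-distrib-+ (degree C) (δ u)) (cong (degreeSum C +_) (sum-δ u))

spanning-copy : {G : FinGraph (p + 2)} → u ≢ v → Isolated (compl G) u → Isolated (compl G) v →
                ∃ λ (S : Subgraph G) → IsCopy (Book p) S × IsBook S u v × vertices S ≡ ⊤
spanning-copy {p = p} {u} {v} {G} u≢v u-iso v-iso =
  bookSubgraph σ , bookSubgraph-isCopy σ |⊤| , bookSubgraph-isBook σ , refl
  where
  full : ∀ {i j} → IsEnd u v i → adj (compl G) i j ≡ false
  full {j = j} (inj₁ refl) = ≢true⇒false (u-iso j)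
  full {j = j} (inj₂ refl) = ≢true⇒false (v-iso j)
  σ : Spine G ⊤ u v
  σ = record { distinct = u≢v ; u∈K = ∈⊤ ; v∈K = ∈⊤ ; full = λ end _ → full end }
  |⊤| : count (lookup (⊤ {p + 2})) ≡ p + 2
  |⊤| = sum-ones λ i → cong indicator ([]=⇒lookup {xs = ⊤} (∈⊤ {x = i}))

indicator≤1 : ∀ b → indicator b ≤ 1
indicator≤1 true  = s≤s z≤n
indicator≤1 false = z≤n

indicator≡1 : ∀ {b} → indicator b ≡ 1 → b ≡ true
indicator≡1 {true} _ = refl

∈-ext : {K K′ : Subset n} → (∀ i → lookup K i ≡ lookup K′ i) → K ≡ K′
∈-ext {K = K} {K′} eq = trans (sym (tabulate∘lookup K)) (trans (tabulate-cong eq) (tabulate∘lookup K′))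

spanning-copy⇒isolated : {G : FinGraph (p + 2)} {S : Subgraph G} → IsCopy (Book p) S →
  ∃₂ λ u v → IsBook S u v × vertices S ≡ ⊤ × Isolated (compl G) u × Isolated (compl G) v
spanning-copy⇒isolated {p} {G} {S} φ with copy⇒book φ
... | (u , v , B) , |S| = u , v , B , S≡⊤ , isolated (inj₁ refl) , isolated (inj₂ refl)
  where
  -- The copy has as many vertices as G, so no indicator can fall short of 1.
  all∈ : ∀ i → lookup (vertices S) i ≡ true
  all∈ i = indicator≡1 (sum-tight (indicator≤1 ∘ lookup (vertices S))
    (ℕ.≤-reflexive (trans (sum-ones {p + 2} λ _ → refl) (sym |S|))) i)
  S≡⊤ : vertices S ≡ ⊤
  S≡⊤ = ∈-ext λ i → trans (all∈ i) (sym ([]=⇒lookup {xs = ⊤} (∈⊤ {x = i})))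
  isolated : ∀ {i} → IsEnd u v i → Isolated (compl G) i
  isolated end j ij = true≢false ij (Spine.full (IsBook.spine B) end (lookup⇒[]= j _ (all∈ j)))

-- Books that miss one vertex.

-- A book spanning all vertices but z corresponds to a pair u, v whose only
-- possible neighbour in the complement C is z.
record Pendants (C : FinGraph n) (u v z : Fin n) : Set where
  field
    distinct : u ≢ v
    u≢z      : u ≢ z
    v≢z      : v ≢ z
    only     : ∀ {i j} → IsEnd u v i → adj C i j ≡ true → j ≡ z

pendants-sym : {C : FinGraph n} → Pendants C u v z → Pendants C v u z
pendants-sym P = record
  { distinct = distinct ∘ sym ; u≢z = v≢z ; v≢z = u≢z ; only = only ∘ Sum.swap }
  where open Pendants P

allBut : Fin n → Subset n
allBut z = tabulate λ i → not (does (i ≟ z))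

∈-allBut : {i : Fin n} → i ≢ z → i ∈ₛ allBut z
∈-allBut {z = z} {i} i≢z = lookup⇒[]= i (allBut z)
  (trans (lookup∘tabulate _ i) (cong not (dec-false (i ≟ z) i≢z)))

∉-allBut : ¬ (z ∈ₛ allBut z)
∉-allBut {z = z} z∈ = true≢false
  (trans (sym (lookup∘tabulate _ z)) ([]=⇒lookup z∈)) (cong not (dec-true (z ≟ z) refl))

allBut-injective : allBut z ≡ allBut z′ → z ≡ z′
allBut-injective {z = z} {z′} eq with z ≟ z′
... | yes z≡z′ = z≡z′
... | no  z≢z′ = contradiction (subst (z ∈ₛ_) (sym eq) (∈-allBut z≢z′)) ∉-allBut

count-not : (f : Fin n → Bool) → count f + count (not ∘ f) ≡ n
count-not f = trans (sym (∑-distrib-+ (indicator ∘ f) (indicator ∘ not ∘ f)))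
                    (sum-ones λ i → one (f i))
  where
  one : ∀ b → indicator b + indicator (not b) ≡ 1
  one true  = refl
  one false = refl

count-allBut : (z : Fin n) → count (lookup (allBut z)) + 1 ≡ n
count-allBut {n} z = trans (cong (count (lookup (allBut z)) +_) (sym only-z))
                           (count-not (lookup (allBut z)))
  where
  only-z : count (not ∘ lookup (allBut z)) ≡ 1
  only-z = trans (sum-cong-≗ λ i → trans (cong (indicator ∘ not) (lookup∘tabulate _ i))
    (trans (cong indicator (Bool.not-involutive _)) (δ-sym i z))) (sum-δ z)

p+3≡p+2+1 : ∀ p → p + 3 ≡ p + 2 + 1
p+3≡p+2+1 p = sym (ℕ.+-assoc p 2 1)

pendants⇒copy : {G : FinGraph (p + 3)} → Pendants (compl G) u v z →
                ∃ λ (S : Subgraph G) → IsCopy (Book p) S × IsBook S u v × vertices S ≡ allBut z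
pendants⇒copy {p} {u} {v} {z} {G} P =
  bookSubgraph σ , bookSubgraph-isCopy σ size-allBut , bookSubgraph-isBook σ , refl
  where
  open Pendants P
  full : ∀ {i j} → IsEnd u v i → j ∈ₛ allBut z → adj (compl G) i j ≡ false
  full end j∈ = ≢true⇒false λ ij → contradiction (subst (_∈ₛ allBut z) (only end ij) j∈) ∉-allBut
  σ : Spine G (allBut z) u v
  σ = record { distinct = distinct ; u∈K = ∈-allBut u≢z ; v∈K = ∈-allBut v≢z ; full = full }
  size-allBut : count (lookup (allBut z)) ≡ p + 2
  size-allBut = ℕ.+-cancelʳ-≡ 1 _ _ (trans (count-allBut z) (p+3≡p+2+1 p))

one-missing : {f : Fin (p + 3) → Bool} → count f ≡ p + 2 → count (not ∘ f) ≡ 1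
one-missing {p} {f} |f| = ℕ.+-cancelˡ-≡ (count f) _ _
  (trans (count-not f) (trans (p+3≡p+2+1 p) (cong (_+ 1) (sym |f|))))

copy⇒pendants : {G : FinGraph (p + 3)} {S : Subgraph G} → IsCopy (Book p) S →
  ∃₂ λ u v → ∃ λ z → IsBook S u v × vertices S ≡ allBut z × Pendants (compl G) u v z
copy⇒pendants {p} {G} {S} φ with copy⇒book φ
... | (u , v , B) , |S| with count-witness {f = not ∘ lookup (vertices S)} []
       (ℕ.≤-reflexive (sym (one-missing |S|)))
...   | z , z∉S , _ = u , v , z , B , S≡allBut , record
  { distinct = distinct ; u≢z = ∈⇒≢z u∈K ; v≢z = ∈⇒≢z v∈K
  ; only     = λ {i} {j} end ij → not-member λ j∈S → true≢false ij (full end j∈S) }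
  where
  open Spine (IsBook.spine B)
  ∈⇒≢z : ∀ {i} → i ∈ₛ vertices S → i ≢ z
  ∈⇒≢z i∈S refl = true≢false z∉S (cong not ([]=⇒lookup i∈S))
  not-member : ∀ {j} → ¬ (j ∈ₛ vertices S) → j ≡ z
  not-member {j} j∉S with j ≟ z
  ... | yes j≡z = j≡z
  ... | no  j≢z = contradiction
    (length-≤-count {f = not ∘ lookup (vertices S)} ((j≢z ∷ []) ∷ [] ∷ [])
      (cong not (≢true⇒false (j∉S ∘ lookup⇒[]= j _)) ∷ z∉S ∷ []))
    (ℕ.<⇒≱ (s≤s (ℕ.≤-reflexive (one-missing |S|))))
  S≡allBut : vertices S ≡ allBut z
  S≡allBut = ∈-ext λ i → bool-ext
    (λ e → []=⇒lookup (∈-allBut (∈⇒≢z (lookup⇒[]= i _ e))))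
    (λ e → member i (lookup⇒[]= i (allBut z) e))
    where
    member : ∀ i → i ∈ₛ allBut z → lookup (vertices S) i ≡ true
    member i i∈ with lookup (vertices S) i in eq
    ... | true  = refl
    ... | false with refl ← not-member (λ i∈S → true≢false ([]=⇒lookup i∈S) eq) =
      contradiction i∈ ∉-allBut

-- Only `u′` is located; applying the condition after `pendants-sym` locates `v′` as well. It is
-- vacuous when there are no pendant pairs, so it also serves for book-free graphs.
PendantsUnique : FinGraph n → Set
PendantsUnique C = ∀ {u v z u′ v′ z′} → Pendants C u v z → Pendants C u′ v′ z′ → z ≡ z′ × IsEnd u v u′

-- Both pendant pairs give copies, which must coincide. The missing vertex is recovered from the
-- vertex set, and the spine from the edges because a book has at least four vertices.
one-copy⇒pendants-unique : {G : FinGraph (p + 3)} → 2 ≤ p → ContainsExactlyOneCopy (Book p) G →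
                           PendantsUnique (compl G)
one-copy⇒pendants-unique {p} 2≤p (R , _ , R-only) P Q with pendants⇒copy P | pendants⇒copy Q
... | S , S-copy , S-book , S-vertices | T , T-copy , T-book , T-vertices =
  allBut-injective (trans (sym S-vertices) (trans (proj₁ S≈T) T-vertices)) ,
  ≈⇒same-spine S-book T-book S≈T
    (subst (4 ≤_) (sym (proj₂ (copy⇒book {S = S} S-copy))) (ℕ.+-monoˡ-≤ 2 2≤p))
  where
  S≈T : S ≈ T
  S≈T = trans (sym (proj₁ (R-only {S} S-copy))) (proj₁ (R-only {T} T-copy)) ,
        λ i j → trans (sym (proj₂ (R-only {S} S-copy) i j)) (proj₂ (R-only {T} T-copy) i j)

-- If w were isolated, any x of degree at most 1 would form a pendant pair
-- with it, so at most one such x exists and the remaining degrees are too big.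
degrees-positive : (C : FinGraph n) → 5 ≤ n → PendantsUnique C → degreeSum C ≤ n + 1 →
                   ∀ i → 1 ≤ degree C i
degrees-positive {n} C 5≤n unique Σ≤n+1 w with isolated⊎degree≥1 C w
... | inj₂ pos = pos
... | inj₁ w-iso = contradiction 2n≤n+4 (ℕ.<⇒≱ n+4<2n)
  where
  fresh : (xs : List (Fin n)) → length xs < 5 → ∃ λ z → z ∉ xs
  fresh xs lt with count-witness {f = λ _ → true} xs
    (subst (length xs <_) (sym (sum-ones {n} λ _ → refl)) (ℕ.<-≤-trans lt 5≤n))
  ... | z , _ , z∉xs = z , z∉xs

  isolated-pair : ∀ {x z} → x ≢ w → Isolated C x → w ≢ z → x ≢ z → Pendants C w x z
  isolated-pair {x} {z} x≢w x-iso w≢z x≢z = record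
    { distinct = x≢w ∘ sym ; u≢z = w≢z ; v≢z = x≢z ; only = none }
    where
    none : ∀ {i j} → IsEnd w x i → adj C i j ≡ true → j ≡ z
    none (inj₁ refl) ij = contradiction ij (w-iso _)
    none (inj₂ refl) ij = contradiction ij (x-iso _)

  -- Two isolated vertices are pendant with any third vertex in the role of `z`, so two choices of
  -- it contradict uniqueness.
  others-positive : ∀ x → x ≢ w → 1 ≤ degree C x
  others-positive x x≢w with isolated⊎degree≥1 C x
  ... | inj₂ pos   = pos
  ... | inj₁ x-iso with fresh (w ∷ x ∷ []) (s≤s (s≤s (s≤s z≤n)))
  ...   | z , z∉ with fresh (w ∷ x ∷ z ∷ []) (s≤s (s≤s (s≤s (s≤s z≤n))))
  ...     | z′ , z′∉ = contradiction
    (sym (proj₁ (unique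
      (isolated-pair x≢w x-iso (z∉ ∘ here ∘ sym) (z∉ ∘ there ∘ here ∘ sym))
      (isolated-pair x≢w x-iso (z′∉ ∘ here ∘ sym) (z′∉ ∘ there ∘ here ∘ sym)))))
    (z′∉ ∘ there ∘ there ∘ here)

  pendant : ∀ x → x ≢ w → degree C x ≤ 1 → ∃ λ z → Pendants C w x z
  pendant x x≢w d≤1 with count-witness [] (others-positive x x≢w)
  ... | z , xz , _ = z , record
    { distinct = x≢w ∘ sym
    ; u≢z      = λ { refl → w-iso x (symmetric {G = C} xz) }
    ; v≢z      = irreflexive {G = C} xz
    ; only     = only }
    where
    only : ∀ {i j} → IsEnd w x i → adj C i j ≡ true → j ≡ z
    only (inj₁ refl) ij = contradiction ij (w-iso _)
    only (inj₂ refl) ij = degree≤1⇒unique C d≤1 ij xz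

  -- Weight 2 at `w` and weight 1 at `x` make up whatever is missing to 2 everywhere. Their total 3,
  -- added to the bound n + 1, gives 2n ≤ n + 4, which fails once n is at least 5.
  bump : Fin n → Fin n → ℕ
  bump x i = degree C i + (δ w i + δ w i + δ x i)

  almost-all≥2 : ∃ λ x → ∀ i → 2 ≤ bump x i
  almost-all≥2 with any? (λ x → ¬? (x ≟ w) ×-dec (degree C x ℕ.≤? 1))
  -- There is no exceptional vertex besides `w`, so `w` serves as a default for `x`.
  ... | no none = w , bound
    where
    bound : ∀ i → 2 ≤ bump w i
    bound i with w ≟ i
    ... | yes _  = ℕ.≤-trans (s≤s (s≤s z≤n)) (ℕ.m≤n+m 3 (degree C i))
    ... | no w≢i = ℕ.≤-trans (ℕ.≰⇒> λ d≤1 → none (i , w≢i ∘ sym , d≤1)) (ℕ.m≤m+n _ 0)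
  ... | yes (x , x≢w , d≤1) = x , bound
    where
    bound : ∀ i → 2 ≤ bump x i
    bound i with w ≟ i | x ≟ i
    ... | yes _  | _        = ℕ.≤-trans (s≤s (s≤s z≤n)) (ℕ.m≤n+m (2 + _) (degree C i))
    ... | no _   | yes refl = ℕ.+-monoˡ-≤ 1 (others-positive x x≢w)
    ... | no w≢i | no x≢i with degree C i ℕ.≤? 1
    ...   | no  d≰1   = ℕ.≤-trans (ℕ.≰⇒> d≰1) (ℕ.m≤m+n _ 0)
    -- Swapping the second pair puts `i` in the position that `unique` locates, so `i` would have to
    -- be `w` or `x`.
    ...   | yes d≤1′ with proj₂ (unique (proj₂ (pendant x x≢w d≤1))
                                    (pendants-sym (proj₂ (pendant i (w≢i ∘ sym) d≤1′))))
    ...     | inj₁ i≡w = contradiction (sym i≡w) w≢i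
    ...     | inj₂ i≡x = contradiction (sym i≡x) x≢i

  2n≤n+4 : n * 2 ≤ n + 4
  2n≤n+4 with almost-all≥2
  ... | x , bound = begin
    n * 2
      ≡⟨ sym (sum-const n 2) ⟩
    ∑[ i < n ] 2
      ≤⟨ sum-mono bound ⟩
    ∑[ i < n ] bump x i
      ≡⟨ ∑-distrib-+ (degree C) (λ i → δ w i + δ w i + δ x i) ⟩
    degreeSum C + ∑[ i < n ] (δ w i + δ w i + δ x i)
      ≡⟨ cong (degreeSum C +_) (trans (∑-distrib-+ (λ i → δ w i + δ w i) (δ x))
           (cong₂ _+_ (trans (∑-distrib-+ (δ w) (δ w)) (cong₂ _+_ (sum-δ w) (sum-δ w))) (sum-δ x))) ⟩
    degreeSum C + 3
      ≤⟨ ℕ.+-monoˡ-≤ 3 Σ≤n+1 ⟩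
    n + 1 + 3
      ≡⟨ ℕ.+-assoc n 1 3 ⟩
    n + 4 ∎
    where open ℕ.≤-Reasoning
  n+4<2n : n + 4 < n * 2
  n+4<2n = subst (n + 4 <_) (trans (cong (n +_) (sym (ℕ.+-identityʳ n))) (ℕ.*-comm 2 n))
                  (ℕ.+-monoʳ-< n 5≤n)

-- The cores, and how degrees force a complement to split.

Empty : ∀ s → FinGraph s
Empty s = record { adj = λ _ _ → false ; sym = λ _ _ → refl ; irrefl = λ _ → refl }

-- Core of the extremal complements. For s = 2 one edge of the perfect matching is singled out as
-- the core, so that both complements of order p + 2 have the same number of matched pairs outside
-- the core.
Complete : ∀ s → FinGraph s
Complete s = compl (Empty s)

-- The path 0 – 1 – 2.
Cherry : FinGraph 3
Cherry = record
  { adj    = λ i j → does (i ≟ 1F) xor does (j ≟ 1F)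
  ; sym    = λ i j → Bool.xor-comm (does (i ≟ 1F)) (does (j ≟ 1F))
  ; irrefl = λ i → Bool.xor-same (does (i ≟ 1F)) }

-- Adding 1 at `u` and at `v` makes every degree at least 1 while the sum becomes n. Hence each
-- other vertex has degree exactly 1.
splits-Empty₂ : (C : FinGraph n) {u v : Fin n} → degreeSum C + 2 ≡ n → u ≢ v →
                Isolated C u → Isolated C v → (∀ i → Isolated C i → IsEnd u v i) →
                Splits (Empty 2) C
splits-Empty₂ {n} C {u} {v} Σ+2≡n u≢v u-iso v-iso only = record
  { core           = ends
  ; core-injective = λ {t} {t′} → injective t t′
  ; core-adj       = λ t t′ → ≢true⇒false (ends-isolated t (ends t′))
  ; core-closed    = λ {t} {j} e → contradiction e (ends-isolated t j)
  ; matched        = λ {i} ¬c → degree≡1⇒∃! C (rest≡1 i λ end → ¬c (is-core end)) }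
  where
  ends : Fin 2 → Fin n
  ends 0F = u
  ends 1F = v
  injective : ∀ t t′ → ends t ≡ ends t′ → t ≡ t′
  injective 0F 0F _  = refl
  injective 0F 1F eq = contradiction eq u≢v
  injective 1F 0F eq = contradiction (sym eq) u≢v
  injective 1F 1F _  = refl
  ends-isolated : ∀ t → Isolated C (ends t)
  ends-isolated 0F = u-iso
  ends-isolated 1F = v-iso
  is-core : ∀ {i} → IsEnd u v i → ∃ λ t → ends t ≡ i
  is-core (inj₁ eq) = 0F , sym eq
  is-core (inj₂ eq) = 1F , sym eq
  bump : Fin n → ℕ
  bump i = degree C i + (δ u i + δ v i)
  1≤bump : ∀ i → 1 ≤ bump i
  1≤bump i with u ≟ i | v ≟ i | isolated⊎degree≥1 C i
  ... | yes _ | _     | _        = ℕ.≤-trans (s≤s z≤n) (ℕ.m≤n+m (1 + _) (degree C i))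
  ... | no _  | yes _ | _        = ℕ.m≤n+m 1 (degree C i)
  ... | no _  | no _  | inj₂ pos = ℕ.≤-trans pos (ℕ.m≤m+n _ 0)
  ... | no ≢u | no ≢v | inj₁ iso with only i iso
  ...   | inj₁ eq = contradiction (sym eq) ≢u
  ...   | inj₂ eq = contradiction (sym eq) ≢v
  Σbump : sum bump ≡ ∑[ i < n ] 1
  Σbump = begin
    sum bump
      ≡⟨ ∑-distrib-+ (degree C) (λ i → δ u i + δ v i) ⟩
    degreeSum C + ∑[ i < n ] (δ u i + δ v i)
      ≡⟨ cong (degreeSum C +_) (trans (∑-distrib-+ (δ u) (δ v)) (cong₂ _+_ (sum-δ u) (sum-δ v))) ⟩
    degreeSum C + 2
      ≡⟨ Σ+2≡n ⟩
    n
      ≡⟨ sym (sum-ones {n} λ _ → refl) ⟩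
    ∑[ i < n ] 1 ∎
    where open ≡-Reasoning
  rest≡1 : ∀ i → ¬ IsEnd u v i → degree C i ≡ 1
  rest≡1 i ¬end = sym (trans (sum-tight 1≤bump (ℕ.≤-reflexive Σbump) i)
    (trans (cong (degree C i +_) (cong₂ _+_ (δ-diff (¬end ∘ inj₁ ∘ sym)) (δ-diff (¬end ∘ inj₂ ∘ sym))))
           (ℕ.+-identityʳ _)))

-- The sum exceeds n ones by a single unit, so one vertex `b` has degree 2 and all others degree 1.
-- The two neighbours of `b` have no further neighbours, which closes the path.
splits-Cherry : (C : FinGraph n) → (∀ i → 1 ≤ degree C i) → degreeSum C ≡ n + 1 → Splits Cherry C
splits-Cherry {n} C 1≤d Σ≡n+1 with any? (λ b → 2 ℕ.≤? degree C b)
... | no none = contradiction (trans (sym (sum-ones all≡1)) Σ≡n+1) (ℕ.m≢1+m+n n ∘ flip trans (ℕ.+-suc n 0))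
  where
  all≡1 : ∀ i → degree C i ≡ 1
  all≡1 i = ℕ.≤-antisym (ℕ.≮⇒≥ λ 2≤d → none (i , 2≤d)) (1≤d i)
... | yes (b , 2≤db) with count-witness [] (ℕ.<-trans (s≤s z≤n) 2≤db)
...   | a , ba , _ with count-witness (a ∷ []) 2≤db
...     | c , bc , c∉a = record
  { core           = core
  ; core-injective = λ {t} {t′} → injective t t′
  ; core-adj       = core-adj
  ; core-closed    = λ {t} {j} → closed t j
  ; matched        = λ {i} ¬c → degree≡1⇒∃! C (rest≡1 λ i≡b → ¬c (1F , sym i≡b)) }
  where
  degrees : ∀ i → 1 + δ b i ≡ degree C i
  degrees = sum-tight bound (ℕ.≤-reflexive (trans Σ≡n+1 (sym Σbound)))
    where
    bound : ∀ i → 1 + δ b i ≤ degree C i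
    bound i with b ≟ i
    ... | yes refl = 2≤db
    ... | no  _    = 1≤d i
    Σbound : ∑[ i < n ] (1 + δ b i) ≡ n + 1
    Σbound = trans (∑-distrib-+ (λ _ → 1) (δ b)) (cong₂ _+_ (sum-ones {n} λ _ → refl) (sum-δ b))
  rest≡1 : ∀ {i} → i ≢ b → degree C i ≡ 1
  rest≡1 {i} i≢b = trans (sym (degrees i)) (cong suc (δ-diff (i≢b ∘ sym)))
  a≢b : a ≢ b
  a≢b = irreflexive {G = C} ba ∘ sym
  c≢b : c ≢ b
  c≢b = irreflexive {G = C} bc ∘ sym
  c≢a : c ≢ a
  c≢a = c∉a ∘ here
  core : Fin 3 → Fin n
  core 0F = a
  core 1F = b
  core 2F = c
  injective : ∀ t t′ → core t ≡ core t′ → t ≡ t′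
  injective 0F 0F _  = refl
  injective 0F 1F eq = contradiction eq a≢b
  injective 0F 2F eq = contradiction (sym eq) c≢a
  injective 1F 0F eq = contradiction (sym eq) a≢b
  injective 1F 1F _  = refl
  injective 1F 2F eq = contradiction (sym eq) c≢b
  injective 2F 0F eq = contradiction eq c≢a
  injective 2F 1F eq = contradiction eq c≢b
  injective 2F 2F _  = refl
  a-only : ∀ {j} → adj C a j ≡ true → b ≡ j
  a-only = degree≤1⇒unique C (ℕ.≤-reflexive (rest≡1 a≢b)) (symmetric {G = C} ba)
  c-only : ∀ {j} → adj C c j ≡ true → b ≡ j
  c-only = degree≤1⇒unique C (ℕ.≤-reflexive (rest≡1 c≢b)) (symmetric {G = C} bc)
  closed : ∀ t j → adj C (core t) j ≡ true → ∃ λ t′ → core t′ ≡ j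
  closed 0F j e = 1F , a-only e
  closed 2F j e = 1F , c-only e
  closed 1F j e with a ≟ j | c ≟ j
  ... | yes a≡j | _       = 0F , a≡j
  ... | no _    | yes c≡j = 2F , c≡j
  ... | no a≢j  | no c≢j  = contradiction
    (length-≤-count {f = adj C b} ((a≢j ∷ c≢a ∘ sym ∷ []) ∷ (c≢j ∘ sym ∷ []) ∷ [] ∷ [])
      (ba ∷ e ∷ bc ∷ []))
    (ℕ.<⇒≱ (s≤s (ℕ.≤-reflexive (trans (sym (degrees b)) (cong suc (δ-same b))))))
  core-adj : ∀ t t′ → adj C (core t) (core t′) ≡ adj Cherry t t′
  core-adj 0F 0F = Graph.irrefl C a
  core-adj 0F 1F = symmetric {G = C} ba
  core-adj 0F 2F = ≢true⇒false (c≢b ∘ sym ∘ a-only)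
  core-adj 1F 0F = ba
  core-adj 1F 1F = Graph.irrefl C b
  core-adj 1F 2F = bc
  core-adj 2F 0F = ≢true⇒false (a≢b ∘ sym ∘ c-only)
  core-adj 2F 1F = symmetric {G = C} bc
  core-adj 2F 2F = Graph.irrefl C c

-- Books in graphs whose complement splits.

module _ {L : FinGraph s} {C : FinGraph n} (S : Splits L C) where
  open Splits S

  isolated⇒core : ∀ {i} → Isolated C i → ∃ λ t → core t ≡ i × Isolated L t
  isolated⇒core {i} iso with core? i
  ... | no ¬c = contradiction (proj₁ (proj₂ (matched ¬c))) (iso _)
  ... | yes (t , refl) = t , refl , λ u tu → iso (core u) (trans (core-adj t u) tu)

  module _ {u v z} (L≥1 : ∀ t → ∃ λ u → adj L t u ≡ true) (P : Pendants C u v z) where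

    -- A core without isolated vertices leaves none in C, so an end has some neighbour, and this can
    -- only be `z`.
    apex~end : ∀ {i} → IsEnd u v i → adj C z i ≡ true
    apex~end {i} end with isolated⊎degree≥1 C i
    ... | inj₁ iso = let t , _ , t-iso = isolated⇒core iso ; w , tw = L≥1 t in contradiction tw (t-iso w)
    ... | inj₂ pos with count-witness {f = adj C i} [] pos
    ...   | j , ij , _ = symmetric {G = C} (subst (λ k → adj C i k ≡ true) (Pendants.only P end ij) ij)

    -- A matched vertex has a single neighbour whereas `z` has both `u` and `v`, so `z` lies in the
    -- core and closure brings `u` and `v` in. The search for pendant pairs is thus confined to the
    -- fixed graph L.
    pendants⇒core : ∃ λ t₀ → ∃₂ λ t₁ t₂ →
      (core t₀ ≡ z × core t₁ ≡ u × core t₂ ≡ v) × adj L t₀ t₁ ≡ true × adj L t₀ t₂ ≡ true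
    pendants⇒core with core? z
    ... | no ¬c = contradiction
      (trans (sym (proj₂ (proj₂ (matched ¬c)) (apex~end (inj₁ refl))))
             (proj₂ (proj₂ (matched ¬c)) (apex~end (inj₂ refl))))
      (Pendants.distinct P)
    ... | yes (t₀ , refl) with core-closed (apex~end (inj₁ refl)) | core-closed (apex~end (inj₂ refl))
    ...   | t₁ , refl | t₂ , refl = t₀ , t₁ , t₂ , (refl , refl , refl) ,
      trans (sym (core-adj t₀ t₁)) (apex~end (inj₁ refl)) , trans (sym (core-adj t₀ t₂)) (apex~end (inj₂ refl))

-- Matched vertices have a neighbour in the complement, so the two core vertices are the only
-- isolated ones and every copy has them as its spine.
splits-Empty₂⇒one-copy : {G : FinGraph (p + 2)} → Splits (Empty 2) (compl G) →
                         ContainsExactlyOneCopy (Book p) G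
splits-Empty₂⇒one-copy {p} {G} S
  with spanning-copy {G = G} (core-≢ λ ()) (core-isolated 0F) (core-isolated 1F)
  where
  open Splits S
  core-≢ : ∀ {t t′} → t ≢ t′ → core t ≢ core t′
  core-≢ t≢t′ = t≢t′ ∘ core-injective
  core-isolated : ∀ t → Isolated (compl G) (core t)
  core-isolated t j tj with core-closed tj
  ... | u , refl = true≢false tj (core-adj t u)
... | T , T-copy , T-book , T≡⊤ = T , T-copy , λ {R} → same {R}
  where
  open Splits S
  in-core : ∀ {i} → Isolated (compl G) i → IsEnd (core 0F) (core 1F) i
  in-core iso with isolated⇒core S iso
  ... | 0F , refl , _ = inj₁ refl
  ... | 1F , refl , _ = inj₂ refl
  same : ∀ {R} → IsCopy (Book p) R → T ≈ R
  same {R} R-copy with spanning-copy⇒isolated {S = R} R-copy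
  ... | u , v , R-book , R≡⊤ , u-iso , v-iso =
    same-spine⇒≈ T-book R-book (trans T≡⊤ (sym R≡⊤)) (in-core u-iso) (in-core v-iso)

splits-Complete₂⇒no-copy : {G : FinGraph (p + 2)} → Splits (Complete 2) (compl G) →
                           ¬ ContainsCopy (Book p) G
splits-Complete₂⇒no-copy {G = G} S (T , T-copy) with spanning-copy⇒isolated {S = T} T-copy
... | _ , _ , _ , _ , u-iso , _ with isolated⇒core S u-iso
...   | 0F , _ , t-iso = t-iso 1F refl
...   | 1F , _ , t-iso = t-iso 0F refl

cherry-pendants : {C : FinGraph n} (S : Splits Cherry C) →
                  let open Splits S in Pendants C (core 0F) (core 2F) (core 1F)
cherry-pendants {C = C} S = record
  { distinct = λ eq → contradiction (core-injective eq) λ ()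
  ; u≢z      = λ eq → contradiction (core-injective eq) λ ()
  ; v≢z      = λ eq → contradiction (core-injective eq) λ ()
  ; only     = only }
  where
  open Splits S
  only : ∀ {i j} → IsEnd (core 0F) (core 2F) i → adj C i j ≡ true → j ≡ core 1F
  only (inj₁ refl) ij with core-closed ij
  ... | 0F , refl = contradiction (core-adj 0F 0F) (true≢false ij)
  ... | 1F , refl = refl
  ... | 2F , refl = contradiction (core-adj 0F 2F) (true≢false ij)
  only (inj₂ refl) ij with core-closed ij
  ... | 0F , refl = contradiction (core-adj 2F 0F) (true≢false ij)
  ... | 1F , refl = refl
  ... | 2F , refl = contradiction (core-adj 2F 2F) (true≢false ij)

cherry-pendants-only : {C : FinGraph n} (S : Splits Cherry C) → let open Splits S in
  Pendants C u v z → core 1F ≡ z × IsEnd (core 0F) (core 2F) u × IsEnd (core 0F) (core 2F) v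
cherry-pendants-only {C = C} S P with pendants⇒core S cherry≥1 P
  where
  cherry≥1 : ∀ t → ∃ λ u → adj Cherry t u ≡ true
  cherry≥1 0F = 1F , refl
  cherry≥1 1F = 0F , refl
  cherry≥1 2F = 1F , refl
-- An apex at a leaf of the path sees only the centre, so the two ends would coincide.
... | 0F , 1F , 1F , (_ , refl , refl) , _ = contradiction refl (Pendants.distinct P)
... | 2F , 1F , 1F , (_ , refl , refl) , _ = contradiction refl (Pendants.distinct P)
... | 1F , 0F , 0F , (refl , refl , refl) , _ = refl , inj₁ refl , inj₁ refl
... | 1F , 0F , 2F , (refl , refl , refl) , _ = refl , inj₁ refl , inj₂ refl
... | 1F , 2F , 0F , (refl , refl , refl) , _ = refl , inj₂ refl , inj₁ refl
... | 1F , 2F , 2F , (refl , refl , refl) , _ = refl , inj₂ refl , inj₂ refl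

splits-Cherry⇒one-copy : {G : FinGraph (p + 3)} → Splits Cherry (compl G) →
                         ContainsExactlyOneCopy (Book p) G
splits-Cherry⇒one-copy {p} {G} S with pendants⇒copy {G = G} (cherry-pendants S)
... | T , T-copy , T-book , T-vertices = T , T-copy , λ {R} → same {R}
  where
  same : ∀ {R} → IsCopy (Book p) R → T ≈ R
  same {R} R-copy with copy⇒pendants {S = R} R-copy
  ... | u , v , z , R-book , R-vertices , P with cherry-pendants-only S P
  ...   | refl , u-end , v-end = same-spine⇒≈ T-book R-book (trans T-vertices (sym R-vertices)) u-end v-end

-- Apex and ends would be the three vertices of the triangle, making the ends adjacent; but an end
-- has no neighbour except the apex.
splits-Complete₃⇒no-copy : {G : FinGraph (p + 3)} → Splits (Complete 3) (compl G) →
                           ¬ ContainsCopy (Book p) G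
splits-Complete₃⇒no-copy {G = G} S (T , T-copy) with copy⇒pendants {S = T} T-copy
... | u , v , z , _ , _ , P with pendants⇒core S complete≥1 P
  where
  complete≥1 : ∀ t → ∃ λ u → adj (Complete 3) t u ≡ true
  complete≥1 0F = 1F , refl
  complete≥1 1F = 0F , refl
  complete≥1 2F = 1F , refl
...   | t₀ , t₁ , t₂ , (refl , refl , refl) , _ , t₀~t₂ = irreflexive {G = Complete 3} t₀~t₂
  (sym (core-injective (Pendants.only P (inj₁ refl) (trans (core-adj t₁ t₂)
    (compl-≢ (Empty 3) {t₁} {t₂} λ { refl → Pendants.distinct P refl })))))
  where open Splits S

-- Turán numbers, and uniqueness one edge above them.

size-degreeSum : (G H : FinGraph n) →
  size G + size G + degreeSum (compl G) ≡ size H + size H + degreeSum (compl H)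
size-degreeSum {n} G H = ℕ.+-cancelʳ-≡ n _ _
  (trans (assoc G) (trans (trans (size-compl G) (sym (size-compl H))) (sym (assoc H))))
  where
  assoc : ∀ (G : FinGraph n) → size G + size G + degreeSum (compl G) + n ≡
                               size G + size G + (degreeSum (compl G) + n)
  assoc G = ℕ.+-assoc (size G + size G) _ n

-- E is extremal and U is the graph with one more edge.
unique-above-Turán : (p : ℕ) (E U : FinGraph n) →
  degreeSum (compl E) ≡ degreeSum (compl U) + 2 →
  ¬ ContainsCopy (Book p) E →
  ContainsExactlyOneCopy (Book p) U →
  (∀ G k → degreeSum (compl G) + (k + k) ≡ degreeSum (compl U) → ¬ ¬ ContainsCopy (Book p) G) →
  (∀ G → degreeSum (compl G) ≡ degreeSum (compl U) → ContainsExactlyOneCopy (Book p) G → U ≅ G) →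
  ∃ λ ex → IsTuránNumber n (Book p) ex ×
    ∃! _≅_ λ (G : FinGraph n) → size G ≡ ex + 1 × ContainsExactlyOneCopy (Book p) G
unique-above-Turán {n} p E U ΣE≡ΣU+2 E-free U-one dense unique =
  size E
  , record { attained = E , E-free , refl ; maximal = maximal }
  , U , (size-U , U-one) , λ {G} (size-G , G-one) → unique G (ΣG≡ΣU G size-G) G-one
  where
  -- Measured from U, which has the size of the case k = 0: each edge beyond that lowers the degree
  -- sum by 2. The case k = 0 handles uniqueness, and all k together handle maximality.
  excess : ∀ G k → size G ≡ size E + suc k → degreeSum (compl G) + (k + k) ≡ degreeSum (compl U)
  excess G k eq = ℕ.+-cancelʳ-≡ (size E + size E + 2) _ _ (begin
    degreeSum (compl G) + (k + k) + (size E + size E + 2)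
      ≡⟨ regroup (degreeSum (compl G)) k (size E) ⟩
    size E + suc k + (size E + suc k) + degreeSum (compl G)
      ≡⟨ cong (λ m → m + m + degreeSum (compl G)) (sym eq) ⟩
    size G + size G + degreeSum (compl G)
      ≡⟨ size-degreeSum G E ⟩
    size E + size E + degreeSum (compl E)
      ≡⟨ cong (size E + size E +_) ΣE≡ΣU+2 ⟩
    size E + size E + (degreeSum (compl U) + 2)
      ≡⟨ regroup′ (size E + size E) (degreeSum (compl U)) ⟩
    degreeSum (compl U) + (size E + size E + 2) ∎)
    where
    open ≡-Reasoning
    regroup : ∀ d k e → d + (k + k) + (e + e + 2) ≡ e + suc k + (e + suc k) + d
    regroup = solve-∀
    regroup′ : ∀ e d → e + (d + 2) ≡ d + (e + 2)
    regroup′ = solve-∀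
  maximal : ∀ G → ¬ ContainsCopy (Book p) G → size G ≤ size E
  maximal G G-free with size G ℕ.≤? size E
  ... | yes le = le
  ... | no nle with ℕ.m≤n⇒∃[o]m+o≡n (ℕ.≰⇒> nle)
  ...   | k , eq = contradiction G-free (dense G k (excess G k (trans (sym eq) (sym (ℕ.+-suc (size E) k)))))
  ΣG≡ΣU : ∀ G → size G ≡ size E + 1 → degreeSum (compl G) ≡ degreeSum (compl U)
  ΣG≡ΣU G eq = trans (sym (ℕ.+-identityʳ _)) (excess G 0 eq)
  size-U : size U ≡ size E + 1
  size-U = trans (ℕ.n≡⌊n+n/2⌋ (size U)) (trans (cong ⌊_/2⌋ doubled) (sym (ℕ.n≡⌊n+n/2⌋ (size E + 1))))
    where
    regroup : ∀ e d → e + e + (d + 2) ≡ e + 1 + (e + 1) + d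
    regroup = solve-∀
    doubled : size U + size U ≡ size E + 1 + (size E + 1)
    doubled = ℕ.+-cancelʳ-≡ (degreeSum (compl U)) _ _ (trans (size-degreeSum U E)
      (trans (cong (size E + size E +_) ΣE≡ΣU+2) (regroup (size E) (degreeSum (compl U)))))

order-p+2 : ∀ p r → 2 ≤ p → p + 2 ≡ 2 + (r + r) →
  ∃ λ ex → IsTuránNumber (p + 2) (Book p) ex ×
  ∃! _≅_ λ (G : FinGraph (p + 2)) → size G ≡ ex + 1 × ContainsExactlyOneCopy (Book p) G
order-p+2 p r 2≤p n≡ with splits-exists (Complete 2) r n≡ | splits-exists (Empty 2) r n≡
... | E , E-splits | U , U-splits =
  unique-above-Turán p E U (trans ΣE≡n (sym ΣU+2≡n)) (splits-Complete₂⇒no-copy E-splits)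
    (splits-Empty₂⇒one-copy U-splits) dense unique
  where
  ΣE≡n : degreeSum (compl E) ≡ p + 2
  ΣE≡n = ℕ.+-cancelʳ-≡ 2 _ _ (splits-degreeSum E-splits)
  ΣU+2≡n : degreeSum (compl U) + 2 ≡ p + 2
  ΣU+2≡n = trans (splits-degreeSum U-splits) (ℕ.+-identityʳ _)
  dense : ∀ G k → degreeSum (compl G) + (k + k) ≡ degreeSum (compl U) → ¬ ¬ ContainsCopy (Book p) G
  dense G k eq free with two-isolated (compl G) (ℕ.≤-trans
    (ℕ.+-monoˡ-≤ 2 (ℕ.≤-trans (ℕ.m≤m+n _ (k + k)) (ℕ.≤-reflexive eq))) (ℕ.≤-reflexive ΣU+2≡n))
  ... | u , v , u≢v , u-iso , v-iso with spanning-copy {G = G} u≢v u-iso v-iso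
  ...   | T , T-copy , _ = free (T , T-copy)
  unique : ∀ G → degreeSum (compl G) ≡ degreeSum (compl U) → ContainsExactlyOneCopy (Book p) G → U ≅ G
  unique G eq (T , T-copy , T-only) with spanning-copy⇒isolated {S = T} T-copy
  ... | u , v , T-book , _ , u-iso , v-iso = ≅-via-compl (splits-unique U-splits
    (splits-Empty₂ (compl G) (trans (cong (_+ 2) eq) ΣU+2≡n)
      (Spine.distinct (IsBook.spine T-book)) u-iso v-iso only))
    where
    4≤|T| : 4 ≤ count (lookup (vertices T))
    4≤|T| = subst (4 ≤_) (sym (proj₂ (copy⇒book {S = T} T-copy))) (ℕ.+-monoˡ-≤ 2 2≤p)
    -- A third isolated vertex together with `u` would be the spine of another copy; as there is
    -- only one copy, the vertex must be on the spine of `T`.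
    only : ∀ i → Isolated (compl G) i → IsEnd u v i
    only i i-iso with isEnd? u v i
    ... | yes end = end
    ... | no ¬end with spanning-copy {G = G} (¬end ∘ inj₁) i-iso u-iso
    ...   | R , R-copy , R-book , _ = ≈⇒same-spine T-book R-book (T-only {R} R-copy) 4≤|T|

order-p+3 : ∀ p r → 2 ≤ p → p + 3 ≡ 3 + (r + r) →
  ∃ λ ex → IsTuránNumber (p + 3) (Book p) ex ×
  ∃! _≅_ λ (G : FinGraph (p + 3)) → size G ≡ ex + 1 × ContainsExactlyOneCopy (Book p) G
order-p+3 p r 2≤p n≡ with splits-exists (Complete 3) r n≡ | splits-exists Cherry r n≡
... | E , E-splits | U , U-splits =
  unique-above-Turán p E U (trans ΣE≡n+3 (trans (sym (ℕ.+-assoc (p + 3) 1 2)) (cong (_+ 2) (sym ΣU≡n+1))))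
    (splits-Complete₃⇒no-copy E-splits) (splits-Cherry⇒one-copy U-splits) dense unique
  where
  5≤n : 5 ≤ p + 3
  5≤n = ℕ.+-monoˡ-≤ 3 2≤p
  ΣE≡n+3 : degreeSum (compl E) ≡ p + 3 + 3
  ΣE≡n+3 = ℕ.+-cancelʳ-≡ 3 _ _ (trans (splits-degreeSum E-splits) (sym (ℕ.+-assoc (p + 3) 3 3)))
  ΣU≡n+1 : degreeSum (compl U) ≡ p + 3 + 1
  ΣU≡n+1 = ℕ.+-cancelʳ-≡ 3 _ _ (trans (splits-degreeSum U-splits) (sym (ℕ.+-assoc (p + 3) 1 3)))
  to-Cherry : ∀ G k → PendantsUnique (compl G) → degreeSum (compl G) + (k + k) ≡ p + 3 + 1 →
              Splits Cherry (compl G)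
  to-Cherry G k unique eq = splits-Cherry (compl G) positive (no-slack k eq)
    where
    positive : ∀ i → 1 ≤ degree (compl G) i
    positive = degrees-positive (compl G) 5≤n unique
      (ℕ.≤-trans (ℕ.m≤m+n _ (k + k)) (ℕ.≤-reflexive eq))
    -- Positive degrees sum to at least n, so a degree sum two or more below n + 1 is impossible.
    no-slack : ∀ k → degreeSum (compl G) + (k + k) ≡ p + 3 + 1 → degreeSum (compl G) ≡ p + 3 + 1
    no-slack zero    eq = trans (sym (ℕ.+-identityʳ _)) eq
    no-slack (suc k) eq = contradiction eq (ℕ.>⇒≢ (begin-strict
      p + 3 + 1
        <⟨ ℕ.+-monoʳ-< (p + 3) (s≤s (s≤s z≤n)) ⟩
      p + 3 + (2 + (k + k))
        ≤⟨ ℕ.+-mono-≤ (sum-pos positive) (ℕ.≤-reflexive (cong suc (sym (ℕ.+-suc k k)))) ⟩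
      degreeSum (compl G) + (suc k + suc k) ∎))
      where open ℕ.≤-Reasoning
  dense : ∀ G k → degreeSum (compl G) + (k + k) ≡ degreeSum (compl U) → ¬ ¬ ContainsCopy (Book p) G
  dense G k eq free = free (proj₁ copy , proj₁ (proj₂ copy))
    where
    -- Without a book there is no pendant pair, so uniqueness is vacuous; yet it forces a path on
    -- three vertices, whose leaves form such a pair.
    no-pendants : PendantsUnique (compl G)
    no-pendants P _ = let T , T-copy , _ = pendants⇒copy {G = G} P in contradiction (T , T-copy) free
    copy = pendants⇒copy {G = G} (cherry-pendants (to-Cherry G k no-pendants (trans eq ΣU≡n+1)))
  unique : ∀ G → degreeSum (compl G) ≡ degreeSum (compl U) → ContainsExactlyOneCopy (Book p) G → U ≅ G
  unique G eq G-one = ≅-via-compl (splits-unique U-splits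
    (to-Cherry G 0 (one-copy⇒pendants-unique {G = G} 2≤p G-one)
      (trans (ℕ.+-identityʳ _) (trans eq ΣU≡n+1))))

theorem2 : ∀ (p : ℕ) → 0 < p → 2 ∣ p →
    (∃ λ ex → IsTuránNumber (p + 2) (Book p) ex ×
    ∃! _≅_ λ (G : FinGraph (p + 2)) →
    size G ≡ ex + 1 × ContainsExactlyOneCopy (Book p) G)
    ×
    (∃ λ ex → IsTuránNumber (p + 3) (Book p) ex ×
    ∃! _≅_ λ (G : FinGraph (p + 3)) →
    size G ≡ ex + 1 × ContainsExactlyOneCopy (Book p) G)
theorem2 _ _ (divides (suc q) refl) =
  -- In both orders p vertices lie outside the core, so the matching there has p / 2 = `suc q`
  -- edges.
  order-p+2 (suc q * 2) (suc q) (s≤s (s≤s z≤n)) (n₂ q) ,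
  order-p+3 (suc q * 2) (suc q) (s≤s (s≤s z≤n)) (n₃ q)
  where
  n₂ : ∀ q → suc q * 2 + 2 ≡ 2 + (suc q + suc q)
  n₂ = solve-∀
  n₃ : ∀ q → suc q * 2 + 3 ≡ 3 + (suc q + suc q)
  n₃ = solve-∀
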